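{- Let $t$ be an odd prime. For every integer $n\geq 1$ that is a quadratic nonresidue modulo $t$ and every $0\leq i\leq t-1$, \[ \overline{N}_{t-1}(i,t,n)=\frac{\overline{p}_{t-1}(n)}{t}\equiv 0 \pmod 2 . \] In particular, $\overline{p}_{t-1}(n)\equiv 0 \pmod{2t}$.
   Context: An overpartition of $n$ is a partition of $n$ in which the first occurrence of each distinct part size may be overlined. For a positive integer $s$, an $s$-colored overpartition of $n$ is an $s$-tuple $\vec\pi=(\pi_1,\dots,\pi_s)$ of overpartitions with $\sum_{k=1}^s|\pi_k|=n$, where $|\pi|$ is the sum of the parts of $\pi$. Let $\ell(\pi)$ be the number of parts of $\pi$ (overlined and non-overlined both counted). Let $\overline{p}_s(n)$ be the number of $s$-colored overpartitions of $n$. For $s$ even, the multirank of $\vec\pi=(\pi_1,\dots,\pi_s)$ is $\overline{r}(\vec\pi)=\sum_{k=1}^{s/2}k\bigl(\ell(\pi_k)-\ell(\pi_{s+1-k})\bigr)$. Let $\overline{N}_s(i,t,n)$ be the number of $s$-colored overpartitions of $n$ whose multirank $\overline{r}$ is congruent to $i$ modulo $t$. -}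

module Defs where

open import Data.Nat using (ℕ; zero; suc; _+_; _*_; _∸_; _/_; _≤?_)
open import Data.Nat.Divisibility using (_∣_; _∣?_)
open import Data.Integer as ℤ using (ℤ; +_; ∣_∣)
open import Data.Bool using (Bool; true; false)
open import Data.Product using (_×_; _,_; ∃)
open import Data.List using (List; []; _∷_; [_]; _++_; map; concatMap; length; filter; replicate; upTo; reverse; take)
open import Data.Vec using (Vec; []; _∷_; toList)
open import Relation.Nullary using (¬_)

-- An overpartition is represented as a list of parts (size , overlined?),
-- listed in canonical order: part sizes non-increasing, and among equal
-- sizes the (at most one) overlined copy comes first.
-- The number of parts ℓ(π) is the length of the list.
Overpartition : Set
Overpartition = List (ℕ × Bool)

ℓ : Overpartition → ℕ
ℓ = length

-- ovpUpTo k n : all overpartitions of n whose parts are all ≤ k,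
-- each listed exactly once.  For the part size (suc k) we choose its
-- multiplicity m (with m * suc k ≤ n) and, if m ≥ 1, whether its first
-- occurrence is overlined.
ovpUpTo : ℕ → ℕ → List Overpartition
ovpUpTo zero zero    = [ [] ]
ovpUpTo zero (suc n) = []
ovpUpTo (suc k) n = ovpUpTo k n ++ concatMap withMult (upTo (suc n))
  where
  block : ℕ → Bool → Overpartition
  block m b = (suc k , b) ∷ replicate m (suc k , false)
  -- withMult m : exactly (suc m) copies of the part suc k
  withMult : ℕ → List Overpartition
  withMult m with suc m * suc k ≤? n
  ... | Relation.Nullary.yes _ =
        concatMap (λ b → map (block m b ++_) (ovpUpTo k (n ∸ suc m * suc k)))
                  (false ∷ true ∷ [])
  ... | Relation.Nullary.no _ = []

overpartitions : ℕ → List Overpartition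
overpartitions n = ovpUpTo n n

coloredOverpartitions : (s n : ℕ) → List (Vec Overpartition s)
coloredOverpartitions zero zero    = [ [] ]
coloredOverpartitions zero (suc n) = []
coloredOverpartitions (suc s) n =
  concatMap (λ j → concatMap (λ π → map (π ∷_) (coloredOverpartitions s (n ∸ j)))
                             (overpartitions j))
            (upTo (suc n))

pbar : (s n : ℕ) → ℕ
pbar s n = length (coloredOverpartitions s n)

weightedDiff : ℕ → List ℕ → List ℕ → ℤ
weightedDiff w (a ∷ as) (b ∷ bs) = (+ w) ℤ.* ((+ a) ℤ.- (+ b)) ℤ.+ weightedDiff (suc w) as bs
weightedDiff w _ _ = + 0

-- multirank r̄(π⃗) = Σ_{k=1}^{s/2} k (ℓ(π_k) − ℓ(π_{s+1−k}))
multirank : {s : ℕ} → Vec Overpartition s → ℤ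
multirank {s} v = weightedDiff 1 (take (s / 2) ls) (take (s / 2) (reverse ls))
  where ls = map ℓ (toList v)

_≡_[modℤ_] : ℤ → ℕ → ℕ → Set
x ≡ i [modℤ t ] = t ∣ ∣ x ℤ.- (+ i) ∣

Nbar : (s i t n : ℕ) → ℕ
Nbar s i t n =
  length (filter (λ π → t ∣? ∣ multirank π ℤ.- (+ i) ∣) (coloredOverpartitions s n))

QuadraticNonresidue : ℕ → ℕ → Set
QuadraticNonresidue t n = ¬ ∃ (λ x → (+ (x * x)) ≡ n [modℤ t ])

{-# OPTIONS --safe #-}
module Submission where

-- Write t for the prime, s = t − 1, and let ζ be a primitive t-th root of unity.  The multirank is congruent
-- to Σ_{k=1}^{s} k ℓ(π_k) modulo t, so Σ_i N(i,t,n) ζ^i is the coefficient of q^n in A = Π_{k=1}^{s} P(ζ^k), where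
-- P(c) = Π_m (1 + c q^m)/(1 − c q^m).  The product G = P(1) A over all k mod t is invariant under q ↦ ζ q, hence a
-- series in q^t, and 1/P(1) = Σ_j (−1)^j q^(j²) by Gauss.  So A = G Σ_j (−1)^j q^(j²) is supported on exponents
-- that are squares modulo t; at a nonresidue n the sum Σ_i N(i,t,n) ζ^i vanishes, which forces all N(i,t,n) to be
-- equal.  They are even because toggling an overline preserves every ℓ(π_k).
--
-- Gauss's identity is the limit of Σ_j (−1)^j q^(j²) / ((q)_{n−j} (q)_{n+j}) = 1 / Π_{m≤n} (1 − q^(2m)), whose
-- left-hand side telescopes in n.

open import Defs
open import Algebra using (AbelianGroup; CommutativeMonoid; CommutativeRing)
open import Data.Bool using (Bool; true; false; if_then_else_)
import Data.Integer.Properties as ℤ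
open import Data.List using (List; []; _∷_; [_]; _++_; map; concatMap; length; filter; applyUpTo; upTo; replicate; take; drop; reverse)
open import Data.List.Properties using (length-++; length-replicate; length-take; length-drop; length-reverse; length-map; reverse-++; unfold-reverse; take++drop≡id)
open import Data.Nat as ℕ using (ℕ; zero; suc; _≤_; _<_; _≤?_; z≤n; s≤s; z<s; s<s)
import Data.Nat.Properties as ℕ
open import Data.Nat.Coprimality using (Coprime; coprime-Bézout)
open import Data.Nat.Divisibility using (_∣_; _∣?_; _∣0; divides; >⇒∤; ∣-refl; ∣m∣n⇒∣m+n; ∣m+n∣m⇒∣n; *-monoˡ-∣; m%n≡0⇒n∣m)
open import Data.Nat.DivMod using (_%_; _/_; m≡m%n+[m/n]*n; m%n<n; m*n/n≡m)
open import Data.Nat.GCD using (module Bézout)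
open import Data.Nat.Induction using (<-rec)
open import Data.Nat.ListAction using (sum)
open import Data.Nat.Primality using (Prime; prime⇒irreducible)
open import Data.Nat.Tactic.RingSolver using () renaming (solve-∀ to ℕ-solve-∀)
open import Data.Product using (∃; _×_; _,_)
open import Data.Sum using (inj₁; inj₂)
open import Data.Vec using (Vec; []; _∷_; toList)
open import Data.Vec.Properties using (length-toList)
open import Function using (_∘_; id; case_of_; _⇔_; mk⇔)
open import Level using (0ℓ)
open import Relation.Binary.PropositionalEquality as ≡ using (_≡_)
open import Relation.Nullary using (¬_; yes; no; does; contradiction)
open import Relation.Nullary.Decidable using (does-⇔; dec-true; dec-false)
open import Relation.Unary using (Pred; Decidable)

-- Everything up to the vanishing of the coefficient is done over an arbitrary commutative ring. Of
-- ζ it uses two facts: ζ^t = 1, and ζ^j x = x forces x = 0 when t does not divide j. The second is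
-- what primality buys: j and t are then coprime. The ring supplied at the end is ℤ[z] acting by
-- shifts on one sequence of period t, chosen so that the vanishing of the sum over coloured
-- overpartitions says outright that consecutive residue counts agree. Infinite objects have finite
-- substitutes. Products run over parts of size at most K, and for each K the invariance under q ↦ ζ
-- q already holds exactly. A quotient u = u₀ / (1 - x) is carried by the recurrence u = u₀ + x u. A
-- limit is carried by agreement of coefficients up to degree n, which costs some care in Gauss's
-- identity: 1/(q)_{n-j} has the right coefficients only up to degree n - j, and the factor q^(j²)
-- has to make up the missing j degrees.

module BigOperators {c ℓ} (M : CommutativeMonoid c ℓ) where
  open CommutativeMonoid M
  open import Algebra.Properties.CommutativeSemigroup commutativeSemigroup using (interchange)
  open import Relation.Binary.Reasoning.Setoid setoid

  ⨁ : ℕ → (ℕ → Carrier) → Carrier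
  ⨁ zero    f = ε
  ⨁ (suc n) f = f 0 ∙ ⨁ n (f ∘ suc)

  ⨁-cong-< : ∀ n {f g} → (∀ k → k < n → f k ≈ g k) → ⨁ n f ≈ ⨁ n g
  ⨁-cong-< zero    f≈g = refl
  ⨁-cong-< (suc n) f≈g = ∙-cong (f≈g 0 z<s) (⨁-cong-< n λ k k<n → f≈g (suc k) (s<s k<n))

  ⨁-cong : ∀ n {f g} → (∀ k → f k ≈ g k) → ⨁ n f ≈ ⨁ n g
  ⨁-cong n f≈g = ⨁-cong-< n λ k _ → f≈g k

  ⨁-ε : ∀ n {f} → (∀ k → k < n → f k ≈ ε) → ⨁ n f ≈ ε
  ⨁-ε zero    f≈ε = refl
  ⨁-ε (suc n) f≈ε = trans (∙-cong (f≈ε 0 z<s) (⨁-ε n λ k k<n → f≈ε (suc k) (s<s k<n))) (identityˡ ε)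

  ⨁-∙ : ∀ n f g → ⨁ n (λ k → f k ∙ g k) ≈ ⨁ n f ∙ ⨁ n g
  ⨁-∙ zero    f g = sym (identityˡ ε)
  ⨁-∙ (suc n) f g = trans (∙-congˡ (⨁-∙ n (f ∘ suc) (g ∘ suc))) (interchange _ _ _ _)

  ⨁-last : ∀ n f → ⨁ (suc n) f ≈ ⨁ n f ∙ f n
  ⨁-last zero    f = comm (f 0) ε
  ⨁-last (suc n) f = trans (∙-congˡ (⨁-last n (f ∘ suc))) (sym (assoc _ _ _))

  ⨁-extend : ∀ a n f → (∀ k → n ≤ k → f k ≈ ε) → ⨁ (a ℕ.+ n) f ≈ ⨁ n f
  ⨁-extend zero    n f f≈ε = refl
  ⨁-extend (suc a) n f f≈ε = trans (⨁-last (a ℕ.+ n) f)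
    (trans (∙-cong (⨁-extend a n f f≈ε) (f≈ε (a ℕ.+ n) (ℕ.m≤n+m n a))) (identityʳ _))

  ⨁-rotate : ∀ n f → f n ≈ f 0 → ⨁ n (f ∘ suc) ≈ ⨁ n f
  ⨁-rotate zero    f fn≈f0 = refl
  ⨁-rotate (suc n) f fn≈f0 = begin
    ⨁ (suc n) (f ∘ suc)        ≈⟨ ⨁-last n (f ∘ suc) ⟩
    ⨁ n (f ∘ suc) ∙ f (suc n)  ≈⟨ ∙-congˡ fn≈f0 ⟩
    ⨁ n (f ∘ suc) ∙ f 0        ≈⟨ comm _ _ ⟩
    ⨁ (suc n) f                ∎

  -- Applied in two monoids: for series under `_⊛_` it says that k ↦ k + d permutes the factors
  -- indexed by residues mod t; for ℕ under addition it moves a window of t consecutive integers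
  -- back to 0.
  ⨁-translate : ∀ n f → (∀ k → f (k ℕ.+ n) ≈ f k) → ∀ a → ⨁ n (λ k → f (a ℕ.+ k)) ≈ ⨁ n f
  ⨁-translate n f per zero    = refl
  ⨁-translate n f per (suc a) = trans (⨁-translate n (f ∘ suc) (λ k → per (suc k)) a) (⨁-rotate n f (per 0))

  ⨁ₗ : ∀ {a} {A : Set a} → (A → Carrier) → List A → Carrier
  ⨁ₗ f []       = ε
  ⨁ₗ f (x ∷ xs) = f x ∙ ⨁ₗ f xs

  module _ {a} {A : Set a} where
    ⨁ₗ-cong : ∀ {f g : A → Carrier} → (∀ x → f x ≈ g x) → ∀ xs → ⨁ₗ f xs ≈ ⨁ₗ g xs
    ⨁ₗ-cong f≈g []       = refl
    ⨁ₗ-cong f≈g (x ∷ xs) = ∙-cong (f≈g x) (⨁ₗ-cong f≈g xs)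

    ⨁ₗ-∙ : ∀ (f g : A → Carrier) xs → ⨁ₗ (λ x → f x ∙ g x) xs ≈ ⨁ₗ f xs ∙ ⨁ₗ g xs
    ⨁ₗ-∙ f g []       = sym (identityˡ ε)
    ⨁ₗ-∙ f g (x ∷ xs) = trans (∙-congˡ (⨁ₗ-∙ f g xs)) (interchange _ _ _ _)

    ⨁ₗ-++ : ∀ (f : A → Carrier) xs ys → ⨁ₗ f (xs ++ ys) ≈ ⨁ₗ f xs ∙ ⨁ₗ f ys
    ⨁ₗ-++ f []       ys = sym (identityˡ _)
    ⨁ₗ-++ f (x ∷ xs) ys = trans (∙-congˡ (⨁ₗ-++ f xs ys)) (sym (assoc _ _ _))

    ⨁ₗ-applyUpTo : ∀ (f : A → Carrier) g n → ⨁ₗ f (applyUpTo g n) ≈ ⨁ n (f ∘ g)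
    ⨁ₗ-applyUpTo f g zero    = refl
    ⨁ₗ-applyUpTo f g (suc n) = ∙-congˡ (⨁ₗ-applyUpTo f (g ∘ suc) n)

    ⨁-⨁ₗ-comm : ∀ n (f : ℕ → A → Carrier) xs →
      ⨁ n (λ k → ⨁ₗ (f k) xs) ≈ ⨁ₗ (λ x → ⨁ n (λ k → f k x)) xs
    ⨁-⨁ₗ-comm n f []       = ⨁-ε n (λ _ _ → refl)
    ⨁-⨁ₗ-comm n f (x ∷ xs) = trans (⨁-∙ n (λ k → f k x) (λ k → ⨁ₗ (f k) xs)) (∙-congˡ (⨁-⨁ₗ-comm n f xs))

    module _ {b} {B : Set b} (f : A → Carrier) where
      ⨁ₗ-map : ∀ (g : B → A) xs → ⨁ₗ f (map g xs) ≈ ⨁ₗ (f ∘ g) xs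
      ⨁ₗ-map g []       = refl
      ⨁ₗ-map g (x ∷ xs) = ∙-congˡ (⨁ₗ-map g xs)

      ⨁ₗ-concatMap : ∀ (g : B → List A) xs → ⨁ₗ f (concatMap g xs) ≈ ⨁ₗ (λ x → ⨁ₗ f (g x)) xs
      ⨁ₗ-concatMap g []       = refl
      ⨁ₗ-concatMap g (x ∷ xs) = trans (⨁ₗ-++ f (g x) (concatMap g xs)) (∙-congˡ (⨁ₗ-concatMap g xs))

-- Finite sums and geometric recurrences in a ring.

module RingSums {c ℓ} (R : CommutativeRing c ℓ) where
  open CommutativeRing R
  open BigOperators +-commutativeMonoid
  open import Algebra.Properties.AbelianGroup +-abelianGroup using (∙-cancelʳ)
  open import Relation.Binary.Reasoning.Setoid setoid

  *-distribˡ-⨁ : ∀ a n f → a * ⨁ n f ≈ ⨁ n (λ k → a * f k)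
  *-distribˡ-⨁ a zero    f = zeroʳ a
  *-distribˡ-⨁ a (suc n) f = trans (distribˡ _ _ _) (+-congˡ (*-distribˡ-⨁ a n (f ∘ suc)))

  *-distribˡ-⨁ₗ : ∀ {b} {A : Set b} a (f : A → Carrier) xs → a * ⨁ₗ f xs ≈ ⨁ₗ (λ x → a * f x) xs
  *-distribˡ-⨁ₗ a f []       = zeroʳ a
  *-distribˡ-⨁ₗ a f (x ∷ xs) = trans (distribˡ _ _ _) (+-congˡ (*-distribˡ-⨁ₗ a f xs))

  x-y+y≈x : ∀ x y → x - y + y ≈ x
  x-y+y≈x x y = trans (+-assoc _ _ _) (trans (+-congˡ (-‿inverseˡ y)) (+-identityʳ x))

  -- Division by 1 - x is always encoded by the recurrence in the premise; this turns it into a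
  -- product equation.
  u≈u₀+xu⇒[1-x]u≈u₀ : ∀ {u x u₀} → u ≈ u₀ + x * u → (1# - x) * u ≈ u₀
  u≈u₀+xu⇒[1-x]u≈u₀ {u} {x} {u₀} eq = ∙-cancelʳ (x * u) _ _ (begin
    (1# - x) * u + x * u  ≈⟨ sym (distribʳ _ _ _) ⟩
    (1# - x + x) * u      ≈⟨ *-congʳ (x-y+y≈x 1# x) ⟩
    1# * u                ≈⟨ *-identityˡ u ⟩
    u                     ≈⟨ eq ⟩
    u₀ + x * u            ∎)

-- Formal power series over a commutative ring.

module PowerSeries {c ℓ} (R : CommutativeRing c ℓ) where
  open import Algebra.Construct.Pointwise ℕ using (abelianGroup)
  open BigOperators
  open CommutativeRing R
  open import Algebra.Properties.CommutativeSemigroup +-commutativeSemigroup using (interchange)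
  open import Algebra.Properties.CommutativeSemigroup *-commutativeSemigroup using (x∙yz≈y∙xz)
  open import Algebra.Properties.Semiring.Exp semiring using (_^_)
  open import Algebra.Properties.AbelianGroup +-abelianGroup using (∙-cancelʳ)
  open import Relation.Binary.Reasoning.Setoid setoid

  Series : Set c
  Series = ℕ → Carrier

  infix 4 _≋_
  infixl 6 _⊕_
  infixl 7 _⊛_
  _≋_ : Series → Series → Set ℓ
  f ≋ g = ∀ n → f n ≈ g n

  tail : Series → Series
  tail f = f ∘ suc

  0ₛ 1ₛ q : Series
  0ₛ _ = 0#
  1ₛ zero    = 1#
  1ₛ (suc _) = 0#
  q zero          = 0#
  q (suc zero)    = 1#
  q (suc (suc _)) = 0#

  infixr 7 _•_
  _•_ : Carrier → Series → Series
  (a • f) n = a * f n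

  _⊕_ : Series → Series → Series
  (f ⊕ g) n = f n + g n

  -- The recursion follows f = f 0 + q · `tail f`, so that the ring laws are inductions on the index
  -- with the series left general; `⊛-coeff` recovers the Cauchy sum.
  _⊛_ : Series → Series → Series
  (f ⊛ g) zero    = f 0 * g 0
  (f ⊛ g) (suc n) = f 0 * g (suc n) + (tail f ⊛ g) n

  ⊛-cong-≤ : ∀ n {f f′ g g′} → (∀ k → k ≤ n → f k ≈ f′ k) → (∀ k → k ≤ n → g k ≈ g′ k) →
             (f ⊛ g) n ≈ (f′ ⊛ g′) n
  ⊛-cong-≤ zero    f≈ g≈ = *-cong (f≈ 0 z≤n) (g≈ 0 z≤n)
  ⊛-cong-≤ (suc n) f≈ g≈ = +-cong (*-cong (f≈ 0 z≤n) (g≈ (suc n) ℕ.≤-refl))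
    (⊛-cong-≤ n (λ k k≤n → f≈ (suc k) (s≤s k≤n)) (λ k k≤n → g≈ k (ℕ.m≤n⇒m≤1+n k≤n)))

  ⊛-cong : ∀ {f f′ g g′} → f ≋ f′ → g ≋ g′ → f ⊛ g ≋ f′ ⊛ g′
  ⊛-cong f≈ g≈ n = ⊛-cong-≤ n (λ k _ → f≈ k) (λ k _ → g≈ k)

  ⊛-distribʳ : ∀ f g h → (g ⊕ h) ⊛ f ≋ (g ⊛ f) ⊕ (h ⊛ f)
  ⊛-distribʳ f g h zero    = distribʳ _ _ _
  ⊛-distribʳ f g h (suc n) =
    trans (+-cong (distribʳ _ _ _) (⊛-distribʳ f (tail g) (tail h) n)) (interchange _ _ _ _)

  •-⊛ : ∀ a f g → (a • f) ⊛ g ≋ a • (f ⊛ g)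
  •-⊛ a f g zero    = *-assoc _ _ _
  •-⊛ a f g (suc n) = trans (+-cong (*-assoc _ _ _) (•-⊛ a (tail f) g n)) (sym (distribˡ _ _ _))

  -- The tail of f ⊛ g unfolds by definition to `(f 0 • tail g) ⊕ (tail f ⊛ g)`, to which
  -- distributivity and the induction hypothesis apply.
  ⊛-assoc : ∀ f g h → (f ⊛ g) ⊛ h ≋ f ⊛ (g ⊛ h)
  ⊛-assoc f g h zero    = *-assoc _ _ _
  ⊛-assoc f g h (suc n) = begin
    f 0 * g 0 * h (suc n) + (((f 0 • tail g) ⊕ (tail f ⊛ g)) ⊛ h) n
      ≈⟨ +-cong (*-assoc _ _ _) (⊛-distribʳ h (f 0 • tail g) (tail f ⊛ g) n) ⟩
    f 0 * (g 0 * h (suc n)) + (((f 0 • tail g) ⊛ h) n + ((tail f ⊛ g) ⊛ h) n)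
      ≈⟨ sym (+-assoc _ _ _) ⟩
    f 0 * (g 0 * h (suc n)) + ((f 0 • tail g) ⊛ h) n + ((tail f ⊛ g) ⊛ h) n
      ≈⟨ +-cong (+-congˡ (•-⊛ (f 0) (tail g) h n)) (⊛-assoc (tail f) g h n) ⟩
    f 0 * (g 0 * h (suc n)) + f 0 * (tail g ⊛ h) n + (tail f ⊛ (g ⊛ h)) n
      ≈⟨ +-congʳ (sym (distribˡ _ _ _)) ⟩
    f 0 * (g 0 * h (suc n) + (tail g ⊛ h) n) + (tail f ⊛ (g ⊛ h)) n ∎

  -- Mirror image of the defining recursion, peeling the second factor; commutativity is the
  -- comparison of the two.
  ⊛-suc : ∀ f g n → (f ⊛ g) (suc n) ≈ g 0 * f (suc n) + (f ⊛ tail g) n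
  ⊛-suc f g zero    = trans (+-comm _ _) (+-congʳ (*-comm _ _))
  ⊛-suc f g (suc n) = begin
    f 0 * g (2 ℕ.+ n) + (tail f ⊛ g) (suc n)
      ≈⟨ +-congˡ (⊛-suc (tail f) g n) ⟩
    f 0 * g (2 ℕ.+ n) + (g 0 * f (2 ℕ.+ n) + (tail f ⊛ tail g) n)
      ≈⟨ sym (+-assoc _ _ _) ⟩
    f 0 * g (2 ℕ.+ n) + g 0 * f (2 ℕ.+ n) + (tail f ⊛ tail g) n
      ≈⟨ +-congʳ (+-comm _ _) ⟩
    g 0 * f (2 ℕ.+ n) + f 0 * g (2 ℕ.+ n) + (tail f ⊛ tail g) n
      ≈⟨ +-assoc _ _ _ ⟩
    g 0 * f (2 ℕ.+ n) + (f ⊛ tail g) (suc n) ∎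

  ⊛-comm : ∀ f g → f ⊛ g ≋ g ⊛ f
  ⊛-comm f g zero    = *-comm _ _
  ⊛-comm f g (suc n) = trans (⊛-suc f g n) (+-congˡ (⊛-comm f (tail g) n))

  ⊛-zeroˡ : ∀ f → 0ₛ ⊛ f ≋ 0ₛ
  ⊛-zeroˡ f zero    = zeroˡ _
  ⊛-zeroˡ f (suc n) = trans (+-cong (zeroˡ _) (⊛-zeroˡ f n)) (+-identityˡ _)

  ⊛-identityˡ : ∀ f → 1ₛ ⊛ f ≋ f
  ⊛-identityˡ f zero    = *-identityˡ _
  ⊛-identityˡ f (suc n) = trans (+-cong (*-identityˡ _) (⊛-zeroˡ f n)) (+-identityʳ _)

  seriesRing : CommutativeRing c ℓ
  seriesRing = record
    { Carrier = Series
    ; _≈_ = _≋_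
    ; _+_ = _⊕_
    ; _*_ = _⊛_
    ; -_ = λ f n → - f n
    ; 0# = 0ₛ
    ; 1# = 1ₛ
    ; isCommutativeRing = record
      { isRing = record
        { +-isAbelianGroup = AbelianGroup.isAbelianGroup (abelianGroup +-abelianGroup)
        ; *-cong = ⊛-cong
        ; *-assoc = ⊛-assoc
        ; *-identity = ⊛-identityˡ , λ f n → trans (⊛-comm f 1ₛ n) (⊛-identityˡ f n)
        ; distrib = (λ f g h n → trans (⊛-comm f (g ⊕ h) n) (trans (⊛-distribʳ f g h n)
                      (+-cong (⊛-comm g f n) (⊛-comm h f n))))
                  , ⊛-distribʳ
        }
      ; *-comm = ⊛-comm
      }
    }

  module S = CommutativeRing seriesRing
  open import Algebra.Properties.Semiring.Exp S.semiring using () renaming (_^_ to _^ₛ_)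

  ⊛-coeff : ∀ f g n → (f ⊛ g) n ≈ ⨁ +-commutativeMonoid (suc n) (λ k → f k * g (n ℕ.∸ k))
  ⊛-coeff f g zero    = sym (+-identityʳ _)
  ⊛-coeff f g (suc n) = +-congˡ (⊛-coeff (tail f) g n)

  -- Strong induction on the index: in degree n + 1 the lower coefficients contribute equally to
  -- both sides, which leaves the unknown coefficient times h 0 = 1.
  ⊛-cancelˡ : ∀ h → h 0 ≈ 1# → ∀ {f g} → h ⊛ f ≋ h ⊛ g → f ≋ g
  ⊛-cancelˡ h h0≈1 {f} {g} hf≋hg = λ n → <-rec (λ n → f n ≈ g n) step n
    where
    head-cancel : ∀ {a b} → h 0 * a ≈ h 0 * b → a ≈ b
    head-cancel {a} {b} eq = begin
      a        ≈⟨ sym (*-identityˡ a) ⟩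
      1# * a   ≈⟨ *-congʳ (sym h0≈1) ⟩
      h 0 * a  ≈⟨ eq ⟩
      h 0 * b  ≈⟨ *-congʳ h0≈1 ⟩
      1# * b   ≈⟨ *-identityˡ b ⟩
      b        ∎
    step : ∀ n → (∀ {k} → k < n → f k ≈ g k) → f n ≈ g n
    step zero    rec = head-cancel (hf≋hg 0)
    step (suc n) rec = head-cancel (∙-cancelʳ ((tail h ⊛ g) n) _ _ (begin
      h 0 * f (suc n) + (tail h ⊛ g) n
        ≈⟨ +-congˡ (⊛-cong-≤ n (λ _ _ → refl) (λ k k≤n → sym (rec (s≤s k≤n)))) ⟩
      h 0 * f (suc n) + (tail h ⊛ f) n ≈⟨ hf≋hg (suc n) ⟩
      h 0 * g (suc n) + (tail h ⊛ g) n ∎))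

  q⊛-zero : ∀ f → (q ⊛ f) 0 ≈ 0#
  q⊛-zero f = zeroˡ _

  q⊛-suc : ∀ f n → (q ⊛ f) (suc n) ≈ f n
  q⊛-suc f n = trans (+-cong (zeroˡ _) (⊛-cong {g = f} tail-q≋1 (λ _ → refl) n))
                     (trans (+-identityˡ _) (⊛-identityˡ f n))
    where
    tail-q≋1 : tail q ≋ 1ₛ
    tail-q≋1 zero    = refl
    tail-q≋1 (suc n) = refl

  q^⊛-+ : ∀ d f n → (q ^ₛ d ⊛ f) (d ℕ.+ n) ≈ f n
  q^⊛-+ zero    f n = ⊛-identityˡ f n
  q^⊛-+ (suc d) f n = begin
    (q ⊛ q ^ₛ d ⊛ f) (suc d ℕ.+ n)    ≈⟨ ⊛-assoc q (q ^ₛ d) f (suc d ℕ.+ n) ⟩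
    (q ⊛ (q ^ₛ d ⊛ f)) (suc d ℕ.+ n)  ≈⟨ q⊛-suc (q ^ₛ d ⊛ f) (d ℕ.+ n) ⟩
    (q ^ₛ d ⊛ f) (d ℕ.+ n)            ≈⟨ q^⊛-+ d f n ⟩
    f n                               ∎

  q^⊛-< : ∀ d f n → n < d → (q ^ₛ d ⊛ f) n ≈ 0#
  q^⊛-< (suc d) f n n<d = trans (⊛-assoc q (q ^ₛ d) f n) (aux n n<d)
    where
    aux : ∀ n → n < suc d → (q ⊛ (q ^ₛ d ⊛ f)) n ≈ 0#
    aux zero    _         = q⊛-zero (q ^ₛ d ⊛ f)
    aux (suc n) (s≤s n<d) = trans (q⊛-suc (q ^ₛ d ⊛ f) n) (q^⊛-< d f n n<d)

  -- The n-th iterate of g ↦ 1 + q x g already has the right coefficients up to n.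
  module _ (x : Series) where
    private
      iter : ℕ → Series
      iter zero    = 1ₛ
      iter (suc N) = 1ₛ ⊕ (q ⊛ (x ⊛ iter N))

      iter-suc : ∀ N n → n ≤ N → iter N n ≈ iter (suc N) n
      iter-suc N zero _ = trans (iter-zero N) (sym (iter-zero (suc N)))
        where
        iter-zero : ∀ N → iter N 0 ≈ 1#
        iter-zero zero    = refl
        iter-zero (suc N) = trans (+-congˡ (q⊛-zero (x ⊛ iter N))) (+-identityʳ 1#)
      iter-suc (suc N) (suc n) (s≤s n≤N) = +-congˡ (begin
        (q ⊛ (x ⊛ iter N)) (suc n)        ≈⟨ q⊛-suc (x ⊛ iter N) n ⟩
        (x ⊛ iter N) n
          ≈⟨ ⊛-cong-≤ n (λ _ _ → refl) (λ k k≤n → iter-suc N k (ℕ.≤-trans k≤n n≤N)) ⟩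
        (x ⊛ iter (suc N)) n              ≈⟨ sym (q⊛-suc (x ⊛ iter (suc N)) n) ⟩
        (q ⊛ (x ⊛ iter (suc N))) (suc n)  ∎)

      iter-stable : ∀ d n → iter n n ≈ iter (d ℕ.+ n) n
      iter-stable zero    n = refl
      iter-stable (suc d) n = trans (iter-stable d n) (iter-suc (d ℕ.+ n) n (ℕ.m≤n+m n d))

    geometric : Series
    geometric n = iter n n

    geometric-unfold : geometric ≋ 1ₛ ⊕ (q ⊛ (x ⊛ geometric))
    geometric-unfold zero = sym (trans (+-congˡ (q⊛-zero (x ⊛ geometric))) (+-identityʳ 1#))
    geometric-unfold (suc n) = +-congˡ (begin
      (q ⊛ (x ⊛ iter n)) (suc n)      ≈⟨ q⊛-suc (x ⊛ iter n) n ⟩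
      (x ⊛ iter n) n                  ≈⟨ ⊛-cong-≤ n (λ _ _ → refl) (λ k k≤n → sym (stable k k≤n)) ⟩
      (x ⊛ geometric) n               ≈⟨ sym (q⊛-suc (x ⊛ geometric) n) ⟩
      (q ⊛ (x ⊛ geometric)) (suc n)   ∎)
      where
      stable : ∀ k → k ≤ n → geometric k ≈ iter n k
      stable k k≤n = trans (iter-stable (n ℕ.∸ k) k) (reflexive (≡.cong (λ N → iter N k) (ℕ.m∸n+n≡m k≤n)))

  module Dilation (a : Carrier) where
    -- The substitution q ↦ a q; the lemmas below make it a ring endomorphism, so it acts on
    -- products factor by factor.
    dilate : Series → Series
    dilate f n = a ^ n * f n

    dilate-cong : ∀ {f g} → f ≋ g → dilate f ≋ dilate g
    dilate-cong f≋g n = *-congˡ (f≋g n)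

    dilate-⊕ : ∀ f g → dilate (f ⊕ g) ≋ dilate f ⊕ dilate g
    dilate-⊕ f g n = distribˡ _ _ _

    dilate-⊛ : ∀ f g → dilate (f ⊛ g) ≋ dilate f ⊛ dilate g
    dilate-⊛ f g zero = trans (*-identityˡ _) (sym (*-cong (*-identityˡ _) (*-identityˡ _)))
    dilate-⊛ f g (suc n) = begin
      a * a ^ n * (f 0 * g (suc n) + (tail f ⊛ g) n)
        ≈⟨ distribˡ _ _ _ ⟩
      a * a ^ n * (f 0 * g (suc n)) + a * a ^ n * (tail f ⊛ g) n
        ≈⟨ +-cong (x∙yz≈y∙xz _ _ _) (*-assoc _ _ _) ⟩
      f 0 * dilate g (suc n) + a * dilate (tail f ⊛ g) n
        ≈⟨ +-cong (*-congʳ (sym (*-identityˡ _))) (*-congˡ (dilate-⊛ (tail f) g n)) ⟩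
      dilate f 0 * dilate g (suc n) + a * (dilate (tail f) ⊛ dilate g) n
        ≈⟨ +-congˡ (sym (•-⊛ a (dilate (tail f)) (dilate g) n)) ⟩
      dilate f 0 * dilate g (suc n) + ((a • dilate (tail f)) ⊛ dilate g) n
        ≈⟨ +-congˡ (⊛-cong {g = dilate g} (λ k → sym (*-assoc _ _ _)) (λ _ → refl) n) ⟩
      dilate f 0 * dilate g (suc n) + (tail (dilate f) ⊛ dilate g) n ∎

    dilate-• : ∀ b f → dilate (b • f) ≋ b • dilate f
    dilate-• b f n = x∙yz≈y∙xz _ _ _

    dilate-1 : dilate 1ₛ ≋ 1ₛ
    dilate-1 zero    = *-identityˡ _
    dilate-1 (suc n) = zeroʳ _

    dilate-q : dilate q ≋ a • q
    dilate-q zero          = trans (zeroʳ _) (sym (zeroʳ _))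
    dilate-q (suc zero)    = *-congʳ (*-identityʳ a)
    dilate-q (suc (suc n)) = trans (zeroʳ _) (sym (zeroʳ _))

-- The finite form of Gauss's identity.

module GaussIdentity {c ℓ} (S : CommutativeRing c ℓ) where
  open CommutativeRing S
  open RingSums S using (u≈u₀+xu⇒[1-x]u≈u₀)
  open BigOperators +-commutativeMonoid
  open import Algebra.Properties.Semiring.Exp semiring using (_^_; ^-homo-*; ^-congʳ)
  open import Algebra.Solver.Ring.NaturalCoefficients.Default commutativeSemiring
  open import Relation.Binary.Reasoning.Setoid setoid

  -- τ j = 2 (−1)^j, and ε j is the coefficient of q^(j²) in Σ_{j∈ℤ} (−1)^j q^(j²).
  τ ε : ℕ → Carrier
  τ zero    = 1# + 1#
  τ (suc j) = - τ j
  ε zero    = 1#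
  ε (suc j) = τ (suc j)

  module _ (q : Carrier) where

    pochhammer⁻ pochhammer⁺ : ℕ → Carrier
    pochhammer⁻ zero    = 1#
    pochhammer⁻ (suc n) = (1# - q ^ suc n) * pochhammer⁻ n
    pochhammer⁺ zero    = 1#
    pochhammer⁺ (suc n) = (1# + q ^ suc n) * pochhammer⁺ n

    partialTheta : ℕ → Carrier
    partialTheta n = ⨁ (suc n) (λ j → ε j * q ^ (j ℕ.* j))

    -- The hypotheses on `w` characterise 1/(q)_n without division: the second one is (1 - q^(n+1))
    -- w(n+1) = w(n).
    module FiniteIdentity (w : ℕ → Carrier) (w-zero : w 0 ≈ 1#)
                          (w-suc : ∀ n → w (suc n) ≈ w n + q ^ suc n * w (suc n)) where

      pochhammer⁻-w : ∀ n → pochhammer⁻ n * w n ≈ 1#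
      pochhammer⁻-w zero    = trans (*-identityˡ _) w-zero
      pochhammer⁻-w (suc n) = begin
        (1# - q ^ suc n) * pochhammer⁻ n * w (suc n)
          ≈⟨ solve 3 (λ a b c → a :* b :* c := b :* (a :* c)) refl _ _ _ ⟩
        pochhammer⁻ n * ((1# - q ^ suc n) * w (suc n))  ≈⟨ *-congˡ (u≈u₀+xu⇒[1-x]u≈u₀ (w-suc n)) ⟩
        pochhammer⁻ n * w n                             ≈⟨ pochhammer⁻-w n ⟩
        1#                                              ∎

      -- w n is 1/(q)_n, and v n is 1/(q)_{n−1} with the convention 1/(q)_{−1} = 0.
      v : ℕ → Carrier
      v zero    = 0#
      v (suc n) = w n

      w-unfold : ∀ d → w d ≈ v d + q ^ d * w d
      w-unfold zero    = sym (trans (+-identityˡ _) (*-identityˡ _))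
      w-unfold (suc d) = w-suc d

      -- The sum over all integers j is folded onto j ≥ 0, the two signs being merged in `ε`. With f
      -- = `w` this is a summand for n; with f = `v` both indices drop by one, which gives the
      -- summand for n - 1.
      term : (ℕ → Carrier) → ℕ → ℕ → Carrier
      term f n j = ε j * (q ^ (j ℕ.* j) * (f (n ℕ.∸ j) * f (n ℕ.+ j)))

      U : ℕ → Carrier
      U n = ⨁ (suc n) (term w n)

      module _ (n : ℕ) where
        -- The two cross terms that arise when both `w (n ∸ j)` and `w (n + j)` are expanded by
        -- `w-unfold`.
        T T′ : ℕ → Carrier
        T  j = q ^ (j ℕ.* j) * (q ^ (n ℕ.∸ j) * (w (n ℕ.∸ j) * v (n ℕ.+ j)))
        T′ j = q ^ (j ℕ.* j) * (q ^ (n ℕ.+ j) * (v (n ℕ.∸ j) * w (n ℕ.+ j)))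

        -- Of the four products in the expansion, the one with both powers of q carries q^(n-j)
        -- q^(n+j) = q^(2n), a factor that does not depend on j and so leaves the sum.
        term-unfold : ∀ j → j ≤ n →
          term w n j ≈ q ^ (n ℕ.+ n) * term w n j + term v n j + ε j * (T j + T′ j)
        term-unfold j j≤n = begin
          ε j * (q ^ (j ℕ.* j) * (w d * w e))
            ≈⟨ *-congˡ (*-congˡ (*-cong (w-unfold d) (w-unfold e))) ⟩
          ε j * (q ^ (j ℕ.* j) * ((v d + q ^ d * w d) * (v e + q ^ e * w e)))
            ≈⟨ solve 8 (λ s a vd x wd ve y we →
                 s :* (a :* ((vd :+ x :* wd) :* (ve :+ y :* we)))
                 := x :* y :* (s :* (a :* (wd :* we))) :+ s :* (a :* (vd :* ve))
                    :+ s :* (a :* (x :* (wd :* ve)) :+ a :* (y :* (vd :* we)))) refl _ _ _ _ _ _ _ _ ⟩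
          q ^ d * q ^ e * term w n j + term v n j + ε j * (T j + T′ j)
            ≈⟨ +-congʳ (+-congʳ (*-congʳ (sym (^-homo-* q d e)))) ⟩
          q ^ (d ℕ.+ e) * term w n j + term v n j + ε j * (T j + T′ j)
            ≈⟨ +-congʳ (+-congʳ (*-congʳ (^-congʳ q d+e≡n+n))) ⟩
          q ^ (n ℕ.+ n) * term w n j + term v n j + ε j * (T j + T′ j) ∎
          where
          d = n ℕ.∸ j
          e = n ℕ.+ j
          d+e≡n+n : d ℕ.+ e ≡ n ℕ.+ n
          d+e≡n+n = ≡.trans (rearrange d n j) (≡.cong (ℕ._+ n) (ℕ.m∸n+n≡m j≤n))
            where
            rearrange : ∀ d n j → d ℕ.+ (n ℕ.+ j) ≡ d ℕ.+ j ℕ.+ n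
            rearrange = ℕ-solve-∀

        -- Rests on (j+1)² + (n - j - 1) = j² + (n + j). Since ε changes sign from j to j + 1, the
        -- cross terms of neighbouring summands cancel.
        T-suc : ∀ j → j < n → T (suc j) ≈ T′ j
        T-suc j j<n = begin
          q ^ (suc j ℕ.* suc j) * (q ^ d * (w d * v (n ℕ.+ suc j)))
            ≈⟨ combine (suc j ℕ.* suc j) d _ ⟩
          q ^ (suc j ℕ.* suc j ℕ.+ d) * (w d * v (n ℕ.+ suc j))
            ≈⟨ *-cong (^-congʳ q exponents) (reflexive (≡.cong₂ (λ a b → v a * v b) (≡.sym n∸j≡1+d) (ℕ.+-suc n j))) ⟩
          q ^ (j ℕ.* j ℕ.+ (n ℕ.+ j)) * (v (n ℕ.∸ j) * w (n ℕ.+ j))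
            ≈⟨ sym (combine (j ℕ.* j) (n ℕ.+ j) _) ⟩
          T′ j ∎
          where
          d = n ℕ.∸ suc j
          combine : ∀ a b z → q ^ a * (q ^ b * z) ≈ q ^ (a ℕ.+ b) * z
          combine a b z = trans (sym (*-assoc _ _ _)) (*-congʳ (sym (^-homo-* q a b)))
          n∸j≡1+d : n ℕ.∸ j ≡ suc d
          n∸j≡1+d = ℕ.+-cancelʳ-≡ j _ _ (≡.trans (ℕ.m∸n+n≡m (ℕ.<⇒≤ j<n))
                      (≡.sym (≡.trans (≡.sym (ℕ.+-suc d j)) (ℕ.m∸n+n≡m j<n))))
          exponents : suc j ℕ.* suc j ℕ.+ d ≡ j ℕ.* j ℕ.+ (n ℕ.+ j)
          exponents = ≡.trans (lemma j d) (≡.cong (λ m → j ℕ.* j ℕ.+ (m ℕ.+ j)) (ℕ.m∸n+n≡m j<n))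
            where
            lemma : ∀ j d → suc j ℕ.* suc j ℕ.+ d ≡ j ℕ.* j ℕ.+ (d ℕ.+ suc j ℕ.+ j)
            lemma = ℕ-solve-∀

        -- Only the last cross term survives a partial sum. At j = 0 the two cross terms coincide,
        -- which yields the 2 in `τ 0`; afterwards `τ J` meets `ε (suc J)` = - `τ J`.
        telescope : ∀ J → J ≤ n →
          ⨁ (suc J) (term w n) ≈ q ^ (n ℕ.+ n) * ⨁ (suc J) (term w n) + ⨁ (suc J) (term v n) + τ J * T′ J
        telescope zero _ = begin
          term w n 0 + 0#
            ≈⟨ +-congʳ (term-unfold 0 z≤n) ⟩
          q ^ (n ℕ.+ n) * term w n 0 + term v n 0 + 1# * (T 0 + T′ 0) + 0#
            ≈⟨ +-congʳ (+-congˡ (*-congˡ (+-congʳ T0≈T′0))) ⟩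
          q ^ (n ℕ.+ n) * term w n 0 + term v n 0 + 1# * (T′ 0 + T′ 0) + 0#
            ≈⟨ solve 4 (λ a x y t → a :* x :+ y :+ con 1 :* (t :+ t) :+ con 0
                 := a :* (x :+ con 0) :+ (y :+ con 0) :+ (con 1 :+ con 1) :* t) refl _ _ _ _ ⟩
          q ^ (n ℕ.+ n) * (term w n 0 + 0#) + (term v n 0 + 0#) + (1# + 1#) * T′ 0 ∎
          where
          T0≈T′0 : T 0 ≈ T′ 0
          T0≈T′0 rewrite ℕ.+-identityʳ n = *-congˡ (*-congˡ (*-comm _ _))
        telescope (suc J) J<n = begin
          ⨁ (suc (suc J)) (term w n)
            ≈⟨ ⨁-last (suc J) (term w n) ⟩
          Σw + term w n (suc J)
            ≈⟨ +-cong (telescope J (ℕ.<⇒≤ J<n)) (term-unfold (suc J) J<n) ⟩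
          a * Σw + Σv + τ J * T′ J + (a * term w n (suc J) + term v n (suc J) + - τ J * (T (suc J) + T′ (suc J)))
            ≈⟨ +-congˡ (+-congˡ (*-congˡ (+-congʳ (T-suc J J<n)))) ⟩
          a * Σw + Σv + τ J * T′ J + (a * term w n (suc J) + term v n (suc J) + - τ J * (T′ J + T′ (suc J)))
            ≈⟨ solve 9 (λ a sw sv t tj w v m tj′ →
                 a :* sw :+ sv :+ t :* tj :+ (a :* w :+ v :+ m :* (tj :+ tj′))
                 := a :* (sw :+ w) :+ (sv :+ v) :+ m :* tj′ :+ (t :+ m) :* tj) refl _ _ _ _ _ _ _ _ _ ⟩
          a * (Σw + term w n (suc J)) + (Σv + term v n (suc J)) + - τ J * T′ (suc J) + (τ J - τ J) * T′ J
            ≈⟨ +-congˡ (trans (*-congʳ (-‿inverseʳ (τ J))) (zeroˡ _)) ⟩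
          a * (Σw + term w n (suc J)) + (Σv + term v n (suc J)) + - τ J * T′ (suc J) + 0#
            ≈⟨ +-identityʳ _ ⟩
          a * (Σw + term w n (suc J)) + (Σv + term v n (suc J)) + - τ J * T′ (suc J)
            ≈⟨ +-congʳ (sym (+-cong (*-congˡ (⨁-last (suc J) (term w n))) (⨁-last (suc J) (term v n)))) ⟩
          a * ⨁ (suc (suc J)) (term w n) + ⨁ (suc (suc J)) (term v n) + - τ J * T′ (suc J) ∎
          where
          a = q ^ (n ℕ.+ n)
          Σw = ⨁ (suc J) (term w n)
          Σv = ⨁ (suc J) (term v n)

      -- At J = n the surviving cross term contains v 0 = 0, and so does the last summand built from
      -- `v`. What remains is (1 - q^(2n)) U(n) = U(n-1) for n = m + 1.
      U-suc : ∀ m → U (suc m) ≈ U m + q ^ (suc m ℕ.+ suc m) * U (suc m)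
      U-suc m = begin
        U n
          ≈⟨ telescope n n ℕ.≤-refl ⟩
        q ^ (n ℕ.+ n) * U n + ⨁ (suc n) (term v n) + τ n * T′ n n
          ≈⟨ +-cong (+-congˡ Σv≈U) (trans (*-congˡ T′≈0) (zeroʳ _)) ⟩
        q ^ (n ℕ.+ n) * U n + U m + 0#
          ≈⟨ trans (+-identityʳ _) (+-comm _ _) ⟩
        U m + q ^ (n ℕ.+ n) * U n ∎
        where
        n = suc m
        v[n∸n]≈0 : v (n ℕ.∸ n) ≈ 0#
        v[n∸n]≈0 = reflexive (≡.cong v (ℕ.n∸n≡0 n))
        T′≈0 : T′ n n ≈ 0#
        T′≈0 = trans (*-congˡ (trans (*-congˡ (trans (*-congʳ v[n∸n]≈0) (zeroˡ _))) (zeroʳ _))) (zeroʳ _)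
        Σv≈U : ⨁ (suc n) (term v n) ≈ U m
        Σv≈U = begin
          ⨁ (suc n) (term v n)        ≈⟨ ⨁-last n (term v n) ⟩
          ⨁ n (term v n) + term v n n
            ≈⟨ +-cong (⨁-cong-< n {term v n} {term w m} λ k k<n → *-congˡ (*-congˡ (*-congʳ
                 (reflexive (≡.cong v (ℕ.+-∸-assoc 1 (ℕ.≤-pred k<n)))))))
                 (trans (*-congˡ (trans (*-congˡ (trans (*-congʳ v[n∸n]≈0) (zeroˡ _))) (zeroʳ _))) (zeroʳ _)) ⟩
          U m + 0#                    ≈⟨ +-identityʳ _ ⟩
          U m                         ∎

      -- Splits 1 - q^(2n) as (1 - q^n)(1 + q^n): with x = q^(n+1), the series (1 + x) U(n+1)
      -- satisfies the geometric recurrence with ratio x and initial term U(n).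
      U-product : ∀ n → U n * (pochhammer⁻ n * pochhammer⁺ n) ≈ 1#
      U-product zero = begin
        (1# * (1# * (w 0 * w 0)) + 0#) * (1# * 1#)
          ≈⟨ *-congʳ (+-congʳ (*-congˡ (*-congˡ (*-cong w-zero w-zero)))) ⟩
        (1# * (1# * (1# * 1#)) + 0#) * (1# * 1#)
          ≈⟨ solve 0 ((con 1 :* (con 1 :* (con 1 :* con 1)) :+ con 0) :* (con 1 :* con 1) := con 1) refl ⟩
        1# ∎
      U-product (suc n) = begin
        U (suc n) * ((1# - x) * pochhammer⁻ n * ((1# + x) * pochhammer⁺ n))
          ≈⟨ solve 5 (λ u y p z e → u :* (y :* p :* (z :* e)) := y :* (z :* u) :* (p :* e)) refl _ _ _ _ _ ⟩
        (1# - x) * ((1# + x) * U (suc n)) * (pochhammer⁻ n * pochhammer⁺ n)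
          ≈⟨ *-congʳ (u≈u₀+xu⇒[1-x]u≈u₀ (begin
               (1# + x) * U (suc n)               ≈⟨ trans (distribʳ _ _ _) (+-congʳ (*-identityˡ _)) ⟩
               U (suc n) + x * U (suc n)          ≈⟨ +-congʳ (U-suc n) ⟩
               U n + q ^ (suc n ℕ.+ suc n) * U (suc n) + x * U (suc n)
                 ≈⟨ +-congʳ (+-congˡ (*-congʳ (^-homo-* q (suc n) (suc n)))) ⟩
               U n + x * x * U (suc n) + x * U (suc n)
                 ≈⟨ solve 3 (λ u x u′ → u :+ x :* x :* u′ :+ x :* u′ := u :+ x :* ((con 1 :+ x) :* u′)) refl _ _ _ ⟩
               U n + x * ((1# + x) * U (suc n))   ∎)) ⟩
        U n * (pochhammer⁻ n * pochhammer⁺ n)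
          ≈⟨ U-product n ⟩
        1# ∎
        where x = q ^ suc n

-- Gauss's identity up to a given degree.

module ThetaSeries {c ℓ} (R : CommutativeRing c ℓ) where
  open CommutativeRing R using (_≈_; refl; sym; trans; +-cong; +-identityʳ; 0#; -‿cong; ring)
  open import Algebra.Properties.Ring ring using (-0#≈0#)
  open PowerSeries R
  open BigOperators S.+-commutativeMonoid
  open RingSums seriesRing using (*-distribˡ-⨁; x-y+y≈x)
  open GaussIdentity seriesRing
  open import Algebra.Properties.Semiring.Exp S.semiring using (_^_; ^-homo-*; ^-congʳ)
  open import Algebra.Solver.Ring.NaturalCoefficients.Default S.commutativeSemiring
  open import Relation.Binary.Reasoning.Setoid S.setoid

  infix 4 _≋[_]_
  -- Congruence modulo q^(n+1), the substitute for limits.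
  _≋[_]_ : Series → ℕ → Series → Set ℓ
  f ≋[ n ] g = ∀ k → k ≤ n → f k ≈ g k

  module _ {n : ℕ} where
    ≋⇒≋[] : ∀ {f g} → f ≋ g → f ≋[ n ] g
    ≋⇒≋[] f≋g k _ = f≋g k

    ≋[]-trans : ∀ {f g h} → f ≋[ n ] g → g ≋[ n ] h → f ≋[ n ] h
    ≋[]-trans p r k k≤n = trans (p k k≤n) (r k k≤n)

    ⊛-cong-≋[] : ∀ {f f′ g g′} → f ≋[ n ] f′ → g ≋[ n ] g′ → f ⊛ g ≋[ n ] f′ ⊛ g′
    ⊛-cong-≋[] p r k k≤n = ⊛-cong-≤ k (λ j j≤k → p j (ℕ.≤-trans j≤k k≤n)) (λ j j≤k → r j (ℕ.≤-trans j≤k k≤n))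

    ⊕-q^-≋[] : ∀ f g {d} → n < d → f ⊕ (q ^ d ⊛ g) ≋[ n ] f
    ⊕-q^-≋[] f g {d} n<d k k≤n =
      trans (+-cong refl (q^⊛-< d g k (ℕ.≤-<-trans k≤n n<d))) (+-identityʳ _)

    ⨁-cong-≋[] : ∀ m {f g} → (∀ j → j < m → f j ≋[ n ] g j) → ⨁ m f ≋[ n ] ⨁ m g
    ⨁-cong-≋[] zero    p k k≤n = refl
    ⨁-cong-≋[] (suc m) p k k≤n =
      +-cong (p 0 (s≤s z≤n) k k≤n) (⨁-cong-≋[] m (λ j j<m → p (suc j) (s≤s j<m)) k k≤n)

  -- 1/(q)_n, since `geometric (q ^ n)` is 1/(1 - q^(n+1)).
  w : ℕ → Series
  w zero    = 1ₛ
  w (suc n) = w n ⊛ geometric (q ^ n)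

  w-suc : ∀ n → w (suc n) ≋ w n ⊕ (q ^ suc n ⊛ w (suc n))
  w-suc n = begin
    w n ⊛ u                                ≈⟨ S.*-congˡ {w n} (geometric-unfold (q ^ n)) ⟩
    w n ⊛ (1ₛ ⊕ (q ⊛ (q ^ n ⊛ u)))         ≈⟨ solve 4 (λ w q p u → w :* (con 1 :+ q :* (p :* u)) := w :+ q :* p :* (w :* u))
                                                S.refl (w n) q (q ^ n) u ⟩
    w n ⊕ (q ⊛ q ^ n ⊛ (w n ⊛ u))          ∎
    where u = geometric (q ^ n)

  open FiniteIdentity q w S.refl w-suc

  private
    p : ℕ → Series
    p = pochhammer⁻ q

  -- Passing from 1/(q)_{n+j} to 1/(q)_{n+j+1} adds a multiple of q^(n+j+1), which is invisible up
  -- to degree n.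
  pw-≋[] : ∀ n j → p n ⊛ w (j ℕ.+ n) ≋[ n ] 1ₛ
  pw-≋[] n zero    = ≋⇒≋[] (pochhammer⁻-w n)
  pw-≋[] n (suc j) = ≋[]-trans (⊛-cong-≋[] {f = p n} (λ _ _ → refl)
    (≋[]-trans (≋⇒≋[] (w-suc (j ℕ.+ n))) (⊕-q^-≋[] (w (j ℕ.+ n)) (w (suc j ℕ.+ n)) (s≤s (ℕ.m≤n+m n j)))))
    (pw-≋[] n j)

  -- (q)_{d+i} / (q)_d is the product of 1 - q^m over d < m ≤ d + i, hence 1 up to degree d; the
  -- factor q^j raises the precision to j + d.
  q^pw-≋[] : ∀ d j i → q ^ j ⊛ (p (i ℕ.+ d) ⊛ w d) ≋[ j ℕ.+ d ] q ^ j
  q^pw-≋[] d j zero    = ≋⇒≋[] (S.trans (S.*-congˡ {q ^ j} (pochhammer⁻-w d)) (S.*-identityʳ (q ^ j)))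
  -- Adding q^(j+m+1) (q)_m / (q)_d does not change coefficients up to degree j + d, and it undoes
  -- the factor 1 - q^(m+1).
  q^pw-≋[] d j (suc i) k k≤ = trans (sym (⊕-q^-≋[] (q ^ j ⊛ (p (suc m) ⊛ w d)) (p m ⊛ w d) (ℕ.+-monoʳ-< j (s≤s (ℕ.m≤n+m d i))) k k≤))
      (trans (step k) (q^pw-≋[] d j i k k≤))
    where
    m = i ℕ.+ d
    x = q ^ suc m
    step : (q ^ j ⊛ (p (suc m) ⊛ w d)) ⊕ (q ^ (j ℕ.+ suc m) ⊛ (p m ⊛ w d)) ≋ q ^ j ⊛ (p m ⊛ w d)
    step = begin
      (q ^ j ⊛ ((1ₛ S.- x) ⊛ p m ⊛ w d)) ⊕ (q ^ (j ℕ.+ suc m) ⊛ (p m ⊛ w d))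
        ≈⟨ S.+-congˡ {q ^ j ⊛ ((1ₛ S.- x) ⊛ p m ⊛ w d)} (S.*-congʳ {p m ⊛ w d} (^-homo-* q j (suc m))) ⟩
      (q ^ j ⊛ ((1ₛ S.- x) ⊛ p m ⊛ w d)) ⊕ (q ^ j ⊛ x ⊛ (p m ⊛ w d))
        ≈⟨ solve 5 (λ a y p w x → a :* (y :* p :* w) :+ a :* x :* (p :* w) := (y :+ x) :* (a :* (p :* w)))
             S.refl (q ^ j) (1ₛ S.- x) (p m) (w d) x ⟩
      (1ₛ S.- x ⊕ x) ⊛ (q ^ j ⊛ (p m ⊛ w d))
        ≈⟨ S.*-congʳ {q ^ j ⊛ (p m ⊛ w d)} (x-y+y≈x 1ₛ x) ⟩
      1ₛ ⊛ (q ^ j ⊛ (p m ⊛ w d))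
        ≈⟨ S.*-identityˡ _ ⟩
      q ^ j ⊛ (p m ⊛ w d) ∎

  -- Splits q^(j²) as q^r q^j; the q^j is what `q^pw-≋[]` needs in order to reach precision n from d
  -- = n - j.
  square-≥ : ∀ j → ∃ λ r → j ℕ.* j ≡ r ℕ.+ j
  square-≥ zero    = 0 , ≡.refl
  square-≥ (suc j) = j ℕ.* suc j , ℕ.+-comm (suc j) _

  term-≋[] : ∀ n j → j ≤ n → p n ⊛ p n ⊛ term w n j ≋[ n ] ε j ⊛ q ^ (j ℕ.* j)
  term-≋[] n j j≤n with square-≥ j
  ... | r , j²≡r+j = ≋[]-trans (≋⇒≋[] expand) (≋[]-trans (⊛-cong-≋[] left right) (≋⇒≋[] collapse))
    where
    d = n ℕ.∸ j
    expand : p n ⊛ p n ⊛ term w n j ≋ ε j ⊛ q ^ r ⊛ (q ^ j ⊛ (p n ⊛ w d)) ⊛ (p n ⊛ w (n ℕ.+ j))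
    expand = begin
      p n ⊛ p n ⊛ (ε j ⊛ (q ^ (j ℕ.* j) ⊛ (w d ⊛ w (n ℕ.+ j))))
        ≈⟨ S.*-congˡ {p n ⊛ p n} (S.*-congˡ {ε j} (S.*-congʳ {w d ⊛ w (n ℕ.+ j)}
             (S.trans (^-congʳ q j²≡r+j) (^-homo-* q r j)))) ⟩
      p n ⊛ p n ⊛ (ε j ⊛ (q ^ r ⊛ q ^ j ⊛ (w d ⊛ w (n ℕ.+ j))))
        ≈⟨ solve 6 (λ p e a b w z → p :* p :* (e :* (a :* b :* (w :* z))) := e :* a :* (b :* (p :* w)) :* (p :* z))
             S.refl (p n) (ε j) (q ^ r) (q ^ j) (w d) (w (n ℕ.+ j)) ⟩
      ε j ⊛ q ^ r ⊛ (q ^ j ⊛ (p n ⊛ w d)) ⊛ (p n ⊛ w (n ℕ.+ j)) ∎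
    j+d≡n : j ℕ.+ d ≡ n
    j+d≡n = ℕ.m+[n∸m]≡n j≤n
    left : ε j ⊛ q ^ r ⊛ (q ^ j ⊛ (p n ⊛ w d)) ≋[ n ] ε j ⊛ q ^ r ⊛ q ^ j
    left = ⊛-cong-≋[] {f = ε j ⊛ q ^ r} (λ _ _ → refl)
      (≡.subst (λ m → q ^ j ⊛ (p m ⊛ w d) ≋[ m ] q ^ j) j+d≡n (q^pw-≋[] d j j))
    right : p n ⊛ w (n ℕ.+ j) ≋[ n ] 1ₛ
    right = ≡.subst (λ m → p n ⊛ w m ≋[ n ] 1ₛ) (ℕ.+-comm j n) (pw-≋[] n j)
    collapse : ε j ⊛ q ^ r ⊛ q ^ j ⊛ 1ₛ ≋ ε j ⊛ q ^ (j ℕ.* j)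
    collapse = begin
      ε j ⊛ q ^ r ⊛ q ^ j ⊛ 1ₛ  ≈⟨ S.*-identityʳ _ ⟩
      ε j ⊛ q ^ r ⊛ q ^ j       ≈⟨ S.*-assoc (ε j) (q ^ r) (q ^ j) ⟩
      ε j ⊛ (q ^ r ⊛ q ^ j)
        ≈⟨ S.*-congˡ {ε j} (S.sym (S.trans (^-congʳ q j²≡r+j) (^-homo-* q r j))) ⟩
      ε j ⊛ q ^ (j ℕ.* j)       ∎

  theta : ℕ → Series
  theta = partialTheta q

  U-≋[]-theta : ∀ n → p n ⊛ p n ⊛ U n ≋[ n ] theta n
  U-≋[]-theta n = ≋[]-trans (≋⇒≋[] (*-distribˡ-⨁ (p n ⊛ p n) (suc n) (term w n)))
    (⨁-cong-≋[] (suc n) λ j j<1+n → term-≋[] n j (ℕ.≤-pred j<1+n))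

  -- The premise says P = (-q)_n / (q)_n. Up to degree n, theta is (q)_n² U(n), and U(n) is exactly
  -- 1/((q)_n (-q)_n).
  theta-inverse : ∀ n P → P ⊛ p n ≋ pochhammer⁺ q n → P ⊛ theta n ≋[ n ] 1ₛ
  theta-inverse n P Pp≋e = ≋[]-trans
    (⊛-cong-≋[] {f = P} (λ _ _ → refl) (λ k k≤n → sym (U-≋[]-theta n k k≤n)))
    (≋⇒≋[] (begin
      P ⊛ (p n ⊛ p n ⊛ U n)
        ≈⟨ solve 3 (λ P p u → P :* (p :* p :* u) := u :* (p :* (P :* p))) S.refl P (p n) (U n) ⟩
      U n ⊛ (p n ⊛ (P ⊛ p n))  ≈⟨ S.*-congˡ {U n} (S.*-congˡ {p n} Pp≋e) ⟩
      U n ⊛ (p n ⊛ pochhammer⁺ q n)  ≈⟨ U-product n ⟩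
      1ₛ ∎))

  -- The coefficients `ε j` live in the ring of series, so they must first be seen to be constants;
  -- only then is each summand concentrated in degree j².
  theta-nonsquare : ∀ n m → ¬ ∃ (λ j → j ℕ.* j ≡ m) → theta n m ≈ 0#
  theta-nonsquare n m nonsquare = go (suc n) (λ j → ε j ⊛ q ^ (j ℕ.* j)) vanish
    where
    τ-const : ∀ j k → τ j (suc k) ≈ 0#
    τ-const zero    k = +-identityʳ 0#
    τ-const (suc j) k = trans (-‿cong (τ-const j k)) -0#≈0#
    ε-const : ∀ j k → ε j (suc k) ≈ 0#
    ε-const zero    k = refl
    ε-const (suc j) k = τ-const (suc j) k
    vanish-+ : ∀ j r → j ℕ.* j ℕ.+ r ≡ m → (q ^ (j ℕ.* j) ⊛ ε j) m ≈ 0#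
    vanish-+ j zero    eq = contradiction (j , ≡.trans (≡.sym (ℕ.+-identityʳ _)) eq) nonsquare
    vanish-+ j (suc r) ≡.refl = trans (q^⊛-+ (j ℕ.* j) (ε j) (suc r)) (ε-const j r)
    vanish : ∀ j → (ε j ⊛ q ^ (j ℕ.* j)) m ≈ 0#
    vanish j = trans (⊛-comm (ε j) (q ^ (j ℕ.* j)) m) (case ℕ.≤-<-connex (j ℕ.* j) m of λ where
      (inj₁ j²≤m) → vanish-+ j (m ℕ.∸ j ℕ.* j) (ℕ.m+[n∸m]≡n j²≤m)
      (inj₂ m<j²) → q^⊛-< (j ℕ.* j) (ε j) m m<j²)
    go : ∀ N f → (∀ j → f j m ≈ 0#) → ⨁ N f m ≈ 0#
    go zero    f f≈0 = refl
    go (suc N) f f≈0 = trans (+-cong (f≈0 0) (go N _ λ j → f≈0 (suc j))) (+-identityʳ _)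

-- The multirank modulo t.

module WeightedSum where
  open import Data.Integer as ℤ using (+_; _+_; _*_; -_; _-_)
  open import Data.Integer.Tactic.RingSolver using (solve-∀)
  open import Relation.Binary.PropositionalEquality using (refl; sym; trans; cong; cong₂; module ≡-Reasoning)
  open ≡-Reasoning

  lengths : ∀ {s} → Vec Overpartition s → List ℕ
  lengths v = map ℓ (toList v)

  weightedSum : ℕ → List ℕ → ℕ
  weightedSum w []       = 0
  weightedSum w (a ∷ as) = w ℕ.* a ℕ.+ weightedSum (suc w) as

  weightedSum-++ : ∀ w as bs → weightedSum w (as ++ bs) ≡ weightedSum w as ℕ.+ weightedSum (length as ℕ.+ w) bs
  weightedSum-++ w []       bs = refl
  weightedSum-++ w (a ∷ as) bs = begin
    w ℕ.* a ℕ.+ weightedSum (suc w) (as ++ bs)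
      ≡⟨ cong (w ℕ.* a ℕ.+_) (weightedSum-++ (suc w) as bs) ⟩
    w ℕ.* a ℕ.+ (weightedSum (suc w) as ℕ.+ weightedSum (length as ℕ.+ suc w) bs)
      ≡⟨ sym (ℕ.+-assoc (w ℕ.* a) _ _) ⟩
    w ℕ.* a ℕ.+ weightedSum (suc w) as ℕ.+ weightedSum (length as ℕ.+ suc w) bs
      ≡⟨ cong (λ u → w ℕ.* a ℕ.+ weightedSum (suc w) as ℕ.+ weightedSum u bs) (ℕ.+-suc (length as) w) ⟩
    w ℕ.* a ℕ.+ weightedSum (suc w) as ℕ.+ weightedSum (suc (length as ℕ.+ w)) bs ∎

  -- Each entry receives one weight counted from the left and one from the right; their sum is the
  -- same for all entries.
  weightedSum-reverse : ∀ w bs →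
    weightedSum 1 (reverse bs) ℕ.+ weightedSum w bs ≡ (length bs ℕ.+ w) ℕ.* sum bs
  weightedSum-reverse w []       = sym (ℕ.*-zeroʳ w)
  weightedSum-reverse w (b ∷ bs) = begin
    weightedSum 1 (reverse (b ∷ bs)) ℕ.+ (w ℕ.* b ℕ.+ W)
      ≡⟨ cong (λ xs → weightedSum 1 xs ℕ.+ (w ℕ.* b ℕ.+ W)) (unfold-reverse b bs) ⟩
    weightedSum 1 (reverse bs ++ [ b ]) ℕ.+ (w ℕ.* b ℕ.+ W)
      ≡⟨ cong (ℕ._+ (w ℕ.* b ℕ.+ W)) (weightedSum-++ 1 (reverse bs) [ b ]) ⟩
    V ℕ.+ ((length (reverse bs) ℕ.+ 1) ℕ.* b ℕ.+ 0) ℕ.+ (w ℕ.* b ℕ.+ W)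
      ≡⟨ cong (λ l → V ℕ.+ ((l ℕ.+ 1) ℕ.* b ℕ.+ 0) ℕ.+ (w ℕ.* b ℕ.+ W)) (length-reverse bs) ⟩
    V ℕ.+ ((length bs ℕ.+ 1) ℕ.* b ℕ.+ 0) ℕ.+ (w ℕ.* b ℕ.+ W)
      ≡⟨ collect V W w b (length bs) ⟩
    V ℕ.+ W ℕ.+ (length bs ℕ.+ suc w) ℕ.* b
      ≡⟨ cong (ℕ._+ (length bs ℕ.+ suc w) ℕ.* b) (weightedSum-reverse (suc w) bs) ⟩
    (length bs ℕ.+ suc w) ℕ.* sum bs ℕ.+ (length bs ℕ.+ suc w) ℕ.* b
      ≡⟨ factor (length bs) w (sum bs) b ⟩
    (suc (length bs) ℕ.+ w) ℕ.* (b ℕ.+ sum bs) ∎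
    where
    V = weightedSum 1 (reverse bs)
    W = weightedSum (suc w) bs
    collect : ∀ V W w b l → V ℕ.+ ((l ℕ.+ 1) ℕ.* b ℕ.+ 0) ℕ.+ (w ℕ.* b ℕ.+ W) ≡ V ℕ.+ W ℕ.+ (l ℕ.+ suc w) ℕ.* b
    collect = ℕ-solve-∀
    factor : ∀ l w S b → (l ℕ.+ suc w) ℕ.* S ℕ.+ (l ℕ.+ suc w) ℕ.* b ≡ (suc l ℕ.+ w) ℕ.* (b ℕ.+ S)
    factor = ℕ-solve-∀

  weightedDiff-≡ : ∀ w as bs → length as ≡ length bs →
    weightedDiff w as bs ≡ + weightedSum w as - + weightedSum w bs
  weightedDiff-≡ w []       []       _  = refl
  weightedDiff-≡ w (a ∷ as) (b ∷ bs) eq = begin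
    + w * (+ a - + b) + weightedDiff (suc w) as bs
      ≡⟨ cong (_+_ (+ w * (+ a - + b))) (weightedDiff-≡ (suc w) as bs (ℕ.suc-injective eq)) ⟩
    + w * (+ a - + b) + (+ x - + y)
      ≡⟨ lemma (+ w) (+ a) (+ b) (+ x) (+ y) ⟩
    (+ w * + a + + x) - (+ w * + b + + y)
      ≡⟨ cong₂ (λ p r → (p + + x) - (r + + y)) (sym (ℤ.pos-* w a)) (sym (ℤ.pos-* w b)) ⟩
    + weightedSum w (a ∷ as) - + weightedSum w (b ∷ bs) ∎
    where
    x = weightedSum (suc w) as
    y = weightedSum (suc w) bs
    lemma : ∀ w a b x y → w * (a - b) + (x - y) ≡ (w * a + x) - (w * b + y)
    lemma = solve-∀

  take-length-++ : ∀ {A : Set} (xs ys : List A) → take (length xs) (xs ++ ys) ≡ xs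
  take-length-++ []       ys = refl
  take-length-++ (x ∷ xs) ys = cong (x ∷_) (take-length-++ xs ys)

  -- The weight −k attached to the colour t − k is t − k modulo t = 2h + 1.
  weightedDiff-halves : ∀ h as bs → length as ≡ h → length bs ≡ h →
    weightedDiff 1 (take h (as ++ bs)) (take h (reverse (as ++ bs))) ≡
    + weightedSum 1 (as ++ bs) - + (suc (h ℕ.* 2) ℕ.* sum bs)
  weightedDiff-halves h as bs refl |bs| = begin
    weightedDiff 1 (take h (as ++ bs)) (take h (reverse (as ++ bs)))
      ≡⟨ cong₂ (weightedDiff 1) (take-length-++ as bs) (begin
           take h (reverse (as ++ bs))           ≡⟨ cong (take h) (reverse-++ as bs) ⟩
           take h (reverse bs ++ reverse as)     ≡⟨ cong (λ l → take l (reverse bs ++ reverse as)) (sym |rev|) ⟩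
           take (length (reverse bs)) (reverse bs ++ reverse as)  ≡⟨ take-length-++ (reverse bs) _ ⟩
           reverse bs                            ∎) ⟩
    weightedDiff 1 as (reverse bs)
      ≡⟨ weightedDiff-≡ 1 as (reverse bs) (sym |rev|) ⟩
    + weightedSum 1 as - + weightedSum 1 (reverse bs)
      ≡⟨ lemma (+ weightedSum 1 as) (+ weightedSum 1 (reverse bs)) (+ weightedSum (h ℕ.+ 1) bs) ⟩
    + (weightedSum 1 as ℕ.+ weightedSum (h ℕ.+ 1) bs) - + (weightedSum 1 (reverse bs) ℕ.+ weightedSum (h ℕ.+ 1) bs)
      ≡⟨ cong₂ (λ x y → + x - + y) (sym (weightedSum-++ 1 as bs))
           (trans (weightedSum-reverse (h ℕ.+ 1) bs) (cong (ℕ._* sum bs) size)) ⟩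
    + weightedSum 1 (as ++ bs) - + (suc (h ℕ.* 2) ℕ.* sum bs) ∎
    where
    |rev| : length (reverse bs) ≡ h
    |rev| = trans (length-reverse bs) |bs|
    size : length bs ℕ.+ (h ℕ.+ 1) ≡ suc (h ℕ.* 2)
    size = trans (cong (ℕ._+ (h ℕ.+ 1)) |bs|) (double h)
      where
      double : ∀ h → h ℕ.+ (h ℕ.+ 1) ≡ suc (h ℕ.* 2)
      double = ℕ-solve-∀
    lemma : ∀ x y u → x - y ≡ (x + u) - (y + u)
    lemma = solve-∀

  -- The explicit multiple of t = 2h + 1 is kept, since the passage to a congruence later needs it
  -- as a witness.
  multirank-≡ : ∀ h (v : Vec Overpartition (h ℕ.* 2)) →
    multirank v ≡ + weightedSum 1 (lengths v) - + (suc (h ℕ.* 2) ℕ.* sum (drop h (lengths v)))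
  multirank-≡ h v = begin
    multirank v
      ≡⟨ cong (λ k → weightedDiff 1 (take k ls) (take k (reverse ls))) (m*n/n≡m h 2) ⟩
    weightedDiff 1 (take h ls) (take h (reverse ls))
      ≡⟨ cong (λ xs → weightedDiff 1 (take h xs) (take h (reverse xs))) (sym (take++drop≡id h ls)) ⟩
    weightedDiff 1 (take h (as ++ bs)) (take h (reverse (as ++ bs)))
      ≡⟨ weightedDiff-halves h as bs |as| |bs| ⟩
    + weightedSum 1 (as ++ bs) - + (suc (h ℕ.* 2) ℕ.* sum bs)
      ≡⟨ cong (λ xs → + weightedSum 1 xs - + (suc (h ℕ.* 2) ℕ.* sum bs)) (take++drop≡id h ls) ⟩
    + weightedSum 1 ls - + (suc (h ℕ.* 2) ℕ.* sum bs) ∎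
    where
    ls = lengths v
    as = take h ls
    bs = drop h ls
    |ls| : length ls ≡ h ℕ.+ h
    |ls| = trans (length-map ℓ (toList v)) (trans (length-toList v)
             (trans (ℕ.*-comm h 2) (cong (h ℕ.+_) (ℕ.+-identityʳ h))))
    |as| : length as ≡ h
    |as| = trans (length-take h ls) (trans (cong (h ℕ.⊓_) |ls|) (ℕ.m≤n⇒m⊓n≡m (ℕ.m≤m+n h h)))
    |bs| : length bs ≡ h
    |bs| = trans (length-drop h ls) (trans (cong (ℕ._∸ h) |ls|) (ℕ.m+n∸n≡m h h))

-- Sums over overpartitions of functions of the number of parts.

module OverpartitionSums {c ℓ₁} (M : CommutativeMonoid c ℓ₁) where
  open CommutativeMonoid M
  open import Algebra.Properties.CommutativeSemigroup commutativeSemigroup using (interchange)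
  open BigOperators M
  open WeightedSum using (lengths)
  open import Relation.Binary.Reasoning.Setoid setoid

  summands : ∀ {g : ℕ → List Overpartition} {xs ys zs} → zs ≡ ys ++ concatMap g xs → ℕ → List Overpartition
  summands {g} _ = g

  -- The local function withMult of ovpUpTo cannot be named from here; unification recovers it.
  withMult : (k n m : ℕ) → List Overpartition
  withMult k n = summands {xs = upTo (suc n)} {ovpUpTo k n} {ovpUpTo (suc k) n} ≡.refl

  -- The share of the overpartitions of n with exactly m + 1 copies of the largest part k + 1, for
  -- one of the two overline choices.
  fiber : (k n : ℕ) → (ℕ → Carrier) → ℕ → Carrier
  fiber k n F m with suc m ℕ.* suc k ≤? n
  ... | yes _ = ⨁ₗ (λ π → F (suc m ℕ.+ ℓ π)) (ovpUpTo k (n ℕ.∸ suc m ℕ.* suc k))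
  ... | no _  = ε

  fiber-≤ : ∀ k n F m → suc m ℕ.* suc k ≤ n →
    fiber k n F m ≡ ⨁ₗ (λ π → F (suc m ℕ.+ ℓ π)) (ovpUpTo k (n ℕ.∸ suc m ℕ.* suc k))
  fiber-≤ k n F m le with suc m ℕ.* suc k ≤? n
  ... | yes _   = ≡.refl
  ... | no  nle = contradiction le nle

  fiber-> : ∀ k n F m → n < suc m ℕ.* suc k → fiber k n F m ≡ ε
  fiber-> k n F m gt with suc m ℕ.* suc k ≤? n
  ... | yes le = contradiction le (ℕ.<⇒≱ gt)
  ... | no  _  = ≡.refl

  ⨁ₗ-withMult : ∀ k n (F : ℕ → Carrier) m → ⨁ₗ (F ∘ ℓ) (withMult k n m) ≈ fiber k n F m ∙ fiber k n F m
  ⨁ₗ-withMult k n F m with suc m ℕ.* suc k ≤? n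
  ... | no  _ = sym (identityˡ ε)
  ... | yes _ = trans (⨁ₗ-concatMap (F ∘ ℓ) blocks (false ∷ true ∷ []))
                      (∙-cong (branch false) (trans (identityʳ _) (branch true)))
    where
    rest = ovpUpTo k (n ℕ.∸ suc m ℕ.* suc k)
    blocks : Bool → List Overpartition
    blocks b = map (((suc k , b) ∷ replicate m (suc k , false)) ++_) rest
    branch : ∀ b → ⨁ₗ (F ∘ ℓ) (blocks b) ≈ ⨁ₗ (λ π → F (suc m ℕ.+ ℓ π)) rest
    branch b = trans (⨁ₗ-map (F ∘ ℓ) _ rest) (⨁ₗ-cong (λ π → reflexive (≡.cong (F ∘ suc)
      (≡.trans (length-++ (replicate m (suc k , false))) (≡.cong (ℕ._+ ℓ π) (length-replicate m))))) rest)

  -- The overline of the part k + 1 does not affect ℓ, so its two choices contribute equal sums.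
  -- Over a ring this doubling leads to the factor (1 + x)/(1 - x); over ℕ it gives the parity.
  ⨁ₗ-ovpUpTo-suc : ∀ k n (F : ℕ → Carrier) →
    ⨁ₗ (F ∘ ℓ) (ovpUpTo (suc k) n) ≈
    ⨁ₗ (F ∘ ℓ) (ovpUpTo k n) ∙ (⨁ (suc n) (fiber k n F) ∙ ⨁ (suc n) (fiber k n F))
  ⨁ₗ-ovpUpTo-suc k n F = begin
    ⨁ₗ (F ∘ ℓ) (ovpUpTo (suc k) n)
      ≈⟨ ⨁ₗ-++ (F ∘ ℓ) (ovpUpTo k n) (concatMap (withMult k n) (upTo (suc n))) ⟩
    ⨁ₗ (F ∘ ℓ) (ovpUpTo k n) ∙ ⨁ₗ (F ∘ ℓ) (concatMap (withMult k n) (upTo (suc n)))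
      ≈⟨ ∙-congˡ (begin
           ⨁ₗ (F ∘ ℓ) (concatMap (withMult k n) (upTo (suc n)))
             ≈⟨ ⨁ₗ-concatMap (F ∘ ℓ) (withMult k n) (upTo (suc n)) ⟩
           ⨁ₗ (λ m → ⨁ₗ (F ∘ ℓ) (withMult k n m)) (upTo (suc n))
             ≈⟨ ⨁ₗ-applyUpTo (λ m → ⨁ₗ (F ∘ ℓ) (withMult k n m)) id (suc n) ⟩
           ⨁ (suc n) (λ m → ⨁ₗ (F ∘ ℓ) (withMult k n m))
             ≈⟨ ⨁-cong (suc n) (⨁ₗ-withMult k n F) ⟩
           ⨁ (suc n) (λ m → fiber k n F m ∙ fiber k n F m)
             ≈⟨ ⨁-∙ (suc n) (fiber k n F) (fiber k n F) ⟩
           ⨁ (suc n) (fiber k n F) ∙ ⨁ (suc n) (fiber k n F) ∎) ⟩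
    ⨁ₗ (F ∘ ℓ) (ovpUpTo k n) ∙ (⨁ (suc n) (fiber k n F) ∙ ⨁ (suc n) (fiber k n F)) ∎

  ⨁ₗ-ovpUpTo-stable : ∀ d n (F : ℕ → Carrier) →
    ⨁ₗ (F ∘ ℓ) (ovpUpTo (d ℕ.+ n) n) ≈ ⨁ₗ (F ∘ ℓ) (overpartitions n)
  ⨁ₗ-ovpUpTo-stable zero    n F = refl
  ⨁ₗ-ovpUpTo-stable (suc d) n F = begin
    ⨁ₗ (F ∘ ℓ) (ovpUpTo (suc d ℕ.+ n) n)   ≈⟨ ⨁ₗ-ovpUpTo-suc (d ℕ.+ n) n F ⟩
    ⨁ₗ (F ∘ ℓ) (ovpUpTo (d ℕ.+ n) n) ∙ (H ∙ H)
      ≈⟨ ∙-cong (⨁ₗ-ovpUpTo-stable d n F) (trans (∙-cong H≈ε H≈ε) (identityˡ ε)) ⟩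
    ⨁ₗ (F ∘ ℓ) (overpartitions n) ∙ ε      ≈⟨ identityʳ _ ⟩
    ⨁ₗ (F ∘ ℓ) (overpartitions n)          ∎
    where
    H = ⨁ (suc n) (fiber (d ℕ.+ n) n F)
    H≈ε : H ≈ ε
    H≈ε = ⨁-ε (suc n) (λ m _ → reflexive (fiber-> (d ℕ.+ n) n F m
            (ℕ.≤-trans (s≤s (ℕ.m≤n+m n d)) (ℕ.m≤m+n _ _))))

  Double : Carrier → Set _
  Double x = ∃ λ y → x ≈ y ∙ y

  Double-resp : ∀ {x y} → x ≈ y → Double y → Double x
  Double-resp x≈y (z , y≈zz) = z , trans x≈y y≈zz

  Double-∙ : ∀ {x y} → Double x → Double y → Double (x ∙ y)
  Double-∙ (a , x≈aa) (b , y≈bb) = a ∙ b , trans (∙-cong x≈aa y≈bb) (interchange _ _ _ _)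

  Double-⨁ : ∀ n f → (∀ k → k < n → Double (f k)) → Double (⨁ n f)
  Double-⨁ zero    f dbl = ε , sym (identityˡ ε)
  Double-⨁ (suc n) f dbl = Double-∙ (dbl 0 (s≤s z≤n)) (Double-⨁ n (f ∘ suc) λ k k<n → dbl (suc k) (s≤s k<n))

  -- Toggling the overline of the largest part preserves the number of parts.
  Double-ovpUpTo : ∀ k n (F : ℕ → Carrier) → Double (⨁ₗ (F ∘ ℓ) (ovpUpTo k (suc n)))
  Double-ovpUpTo zero    n F = ε , sym (identityˡ ε)
  Double-ovpUpTo (suc k) n F = Double-resp (⨁ₗ-ovpUpTo-suc k (suc n) F)
    (Double-∙ (Double-ovpUpTo k n F) (_ , refl))

  ⨁ₗ-colored-suc : ∀ s n (F : List ℕ → Carrier) →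
    ⨁ₗ (F ∘ lengths) (coloredOverpartitions (suc s) n) ≈
    ⨁ (suc n) (λ j → ⨁ₗ (λ π → ⨁ₗ (λ v → F (ℓ π ∷ lengths v)) (coloredOverpartitions s (n ℕ.∸ j))) (overpartitions j))
  ⨁ₗ-colored-suc s n F = trans (⨁ₗ-concatMap (F ∘ lengths) perSize (upTo (suc n)))
    (trans (⨁ₗ-applyUpTo (λ j → ⨁ₗ (F ∘ lengths) (perSize j)) id (suc n))
      (⨁-cong (suc n) λ j → trans (⨁ₗ-concatMap (F ∘ lengths) (perHead j) (overpartitions j))
        (⨁ₗ-cong (λ π → ⨁ₗ-map (F ∘ lengths) (π ∷_) (coloredOverpartitions s (n ℕ.∸ j))) (overpartitions j))))
    where
    perHead : ℕ → Overpartition → List (Vec Overpartition (suc s))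
    perHead j π = map (π ∷_) (coloredOverpartitions s (n ℕ.∸ j))
    perSize : ℕ → List (Vec Overpartition (suc s))
    perSize j = concatMap (perHead j) (overpartitions j)

  -- The toggle acts on the first colour that is not empty; a positive total size guarantees one.
  Double-colored : ∀ s n (F : List ℕ → Carrier) → Double (⨁ₗ (F ∘ lengths) (coloredOverpartitions s (suc n)))
  Double-colored zero    n F = ε , sym (identityˡ ε)
  Double-colored (suc s) n F = Double-resp (⨁ₗ-colored-suc s (suc n) F) (Double-⨁ (suc (suc n)) _ perSize)
    where
    perSize : ∀ j → j < suc (suc n) →
      Double (⨁ₗ (λ π → ⨁ₗ (λ v → F (ℓ π ∷ lengths v)) (coloredOverpartitions s (suc n ℕ.∸ j))) (overpartitions j))
    -- Size 0 admits only the empty overpartition, so the toggle passes to the remaining colours;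
    -- the second summand is the empty rest of the one-element list.
    perSize zero    _ = Double-∙ (Double-colored s n (F ∘ (0 ∷_))) (ε , sym (identityˡ ε))
    perSize (suc j) _ = Double-ovpUpTo (suc j) j
      (λ a → ⨁ₗ (λ v → F (a ∷ lengths v)) (coloredOverpartitions s (n ℕ.∸ j)))

-- The generating function of overpartitions by number of parts.

module OverpartitionSeries {r₁ r₂} (R : CommutativeRing r₁ r₂) where
  open CommutativeRing R
  open BigOperators +-commutativeMonoid
  open RingSums R
  open PowerSeries R
  open OverpartitionSums +-commutativeMonoid
  open import Algebra.Properties.Semiring.Exp semiring using (_^_)
  open import Algebra.Properties.Semiring.Exp S.semiring using () renaming (_^_ to _^ₛ_)
  open import Algebra.Solver.Ring.NaturalCoefficients.Default S.commutativeSemiring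
  open import Relation.Binary.Reasoning.MultiSetoid

  module _ (c : Carrier) where
    -- As a series this is the product over m ≤ K of (1 + c q^m)/(1 - c q^m); the recurrence
    -- `ovp-unfold` expresses that.
    ovp : ℕ → Series
    ovp K n = ⨁ₗ (λ π → c ^ ℓ π) (ovpUpTo K n)

    ovp-zero : ovp 0 ≋ 1ₛ
    ovp-zero zero    = +-identityʳ 1#
    ovp-zero (suc n) = refl

    module _ (k : ℕ) where
      private
        d = suc k
        x = c • q ^ₛ d
        fib : ℕ → ℕ → Carrier
        fib n = fiber k n (c ^_)
        H : Series
        H n = ⨁ (suc n) (fib n)

      x⊛ : ∀ f n → (x ⊛ f) (d ℕ.+ n) ≈ c * f n
      x⊛ f n = trans (•-⊛ c (q ^ₛ d) f (d ℕ.+ n)) (*-congˡ (q^⊛-+ d f n))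

      fib-zero : ∀ n → fib (d ℕ.+ n) 0 ≈ c * ovp k n
      fib-zero n = begin⟨ setoid ⟩
        fib (d ℕ.+ n) 0
          ≈⟨ reflexive (fiber-≤ k (d ℕ.+ n) (c ^_) 0 (ℕ.≤-trans (ℕ.≤-reflexive (ℕ.*-identityˡ d)) (ℕ.m≤m+n d n))) ⟩
        ⨁ₗ (λ π → c * c ^ ℓ π) (ovpUpTo k (d ℕ.+ n ℕ.∸ 1 ℕ.* d))
          ≈⟨ sym (*-distribˡ-⨁ₗ c (λ π → c ^ ℓ π) (ovpUpTo k (d ℕ.+ n ℕ.∸ 1 ℕ.* d))) ⟩
        c * ovp k (d ℕ.+ n ℕ.∸ 1 ℕ.* d)
          ≈⟨ *-congˡ (reflexive (≡.cong (ovp k)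
               (≡.trans (≡.cong (d ℕ.+ n ℕ.∸_) (ℕ.*-identityˡ d)) (ℕ.m+n∸m≡n d n)))) ⟩
        c * ovp k n ∎

      fib-suc : ∀ n m → fib (d ℕ.+ n) (suc m) ≈ c * fib n m
      fib-suc n m with ℕ.≤-<-connex (suc m ℕ.* d) n
      ... | inj₁ le = begin⟨ setoid ⟩
        fib (d ℕ.+ n) (suc m)
          ≈⟨ reflexive (fiber-≤ k (d ℕ.+ n) (c ^_) (suc m) (ℕ.+-monoʳ-≤ d le)) ⟩
        ⨁ₗ (λ π → c * c ^ (suc m ℕ.+ ℓ π)) (ovpUpTo k (d ℕ.+ n ℕ.∸ (d ℕ.+ suc m ℕ.* d)))
          ≈⟨ sym (*-distribˡ-⨁ₗ c _ (ovpUpTo k (d ℕ.+ n ℕ.∸ (d ℕ.+ suc m ℕ.* d)))) ⟩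
        c * ⨁ₗ (λ π → c ^ (suc m ℕ.+ ℓ π)) (ovpUpTo k (d ℕ.+ n ℕ.∸ (d ℕ.+ suc m ℕ.* d)))
          ≈⟨ *-congˡ (reflexive (≡.trans
               (≡.cong (λ r → ⨁ₗ (λ π → c ^ (suc m ℕ.+ ℓ π)) (ovpUpTo k r)) (ℕ.[m+n]∸[m+o]≡n∸o d n (suc m ℕ.* d)))
               (≡.sym (fiber-≤ k n (c ^_) m le)))) ⟩
        c * fib n m ∎
      ... | inj₂ gt = begin⟨ setoid ⟩
        fib (d ℕ.+ n) (suc m)  ≈⟨ reflexive (fiber-> k (d ℕ.+ n) (c ^_) (suc m) (ℕ.+-monoʳ-< d gt)) ⟩
        0#                     ≈⟨ sym (zeroʳ c) ⟩
        c * 0#                 ≈⟨ *-congˡ (reflexive (≡.sym (fiber-> k n (c ^_) m gt))) ⟩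
        c * fib n m            ∎

      fib-> : ∀ n m → n < suc m ℕ.* d → fib n m ≈ 0#
      fib-> n m gt = reflexive (fiber-> k n (c ^_) m gt)

      H-+ : ∀ n → H (d ℕ.+ n) ≈ c * (ovp k n + H n)
      H-+ n = begin⟨ setoid ⟩
        fib (d ℕ.+ n) 0 + ⨁ (d ℕ.+ n) (fib (d ℕ.+ n) ∘ suc)
          ≈⟨ +-cong (fib-zero n) (⨁-cong (d ℕ.+ n) (fib-suc n)) ⟩
        c * ovp k n + ⨁ (d ℕ.+ n) (λ m → c * fib n m)
          ≈⟨ +-congˡ (sym (*-distribˡ-⨁ c (d ℕ.+ n) (fib n))) ⟩
        c * ovp k n + c * ⨁ (d ℕ.+ n) (fib n)
          -- With d = k + 1 the range d + n is k + (n + 1): the range of `H n` and k further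
          -- multiplicities, too large to fit into n.
          ≈⟨ +-congˡ (*-congˡ (reflexive (≡.cong (λ N → ⨁ N (fib n)) (≡.sym (ℕ.+-suc k n))))) ⟩
        c * ovp k n + c * ⨁ (k ℕ.+ suc n) (fib n)
          ≈⟨ +-congˡ (*-congˡ (⨁-extend k (suc n) (fib n) λ m n<m →
               fib-> n m (ℕ.≤-trans (ℕ.m≤n⇒m≤1+n n<m) (ℕ.m≤m*n (suc m) d)))) ⟩
        c * ovp k n + c * H n
          ≈⟨ sym (distribˡ _ _ _) ⟩
        c * (ovp k n + H n) ∎

      -- Removing one copy of the part d, of weight x = c q^d, leaves either no copy, counted by
      -- `ovp k`, or at least one, counted by `H` again.
      H-unfold : H ≋ x ⊛ (ovp k ⊕ H)
      H-unfold n with ℕ.≤-<-connex d n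
      ... | inj₁ d≤n = ≡.subst (λ m → H m ≈ (x ⊛ (ovp k ⊕ H)) m) (ℕ.m+[n∸m]≡n d≤n)
                         (trans (H-+ (n ℕ.∸ d)) (sym (x⊛ (ovp k ⊕ H) (n ℕ.∸ d))))
      ... | inj₂ n<d = trans
        (⨁-ε (suc n) λ m _ → fib-> n m (ℕ.<-≤-trans n<d (ℕ.m≤m+n d (m ℕ.* d))))
        (sym (trans (•-⊛ c (q ^ₛ d) _ n) (trans (*-congˡ (q^⊛-< d _ n n<d)) (zeroʳ c))))

      ovp-unfold : ovp (suc k) ≋ (1ₛ ⊕ x) ⊛ ovp k ⊕ x ⊛ ovp (suc k)
      ovp-unfold = begin⟨ S.setoid ⟩
        ovp (suc k)
          ≈⟨ expand ⟩
        ovp k ⊕ (H ⊕ H)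
          ≈⟨ S.+-congˡ {ovp k} (S.+-cong H-unfold H-unfold) ⟩
        ovp k ⊕ (x ⊛ (ovp k ⊕ H) ⊕ x ⊛ (ovp k ⊕ H))
          ≈⟨ solve 3 (λ o h x → o :+ (x :* (o :+ h) :+ x :* (o :+ h))
                := (con 1 :+ x) :* o :+ x :* (o :+ (h :+ h))) S.refl (ovp k) H x ⟩
        (1ₛ ⊕ x) ⊛ ovp k ⊕ x ⊛ (ovp k ⊕ (H ⊕ H))
          ≈⟨ S.+-congˡ {(1ₛ ⊕ x) ⊛ ovp k} (S.*-congˡ {x} (S.sym expand)) ⟩
        (1ₛ ⊕ x) ⊛ ovp k ⊕ x ⊛ ovp (suc k) ∎
        where
        expand : ovp (suc k) ≋ ovp k ⊕ (H ⊕ H)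
        expand n = ⨁ₗ-ovpUpTo-suc k n (c ^_)

-- Vanishing of the coefficient at a nonresidue.

module Vanishing {r₁ r₂} (R : CommutativeRing r₁ r₂) where
  open CommutativeRing R
  open BigOperators +-commutativeMonoid
  open RingSums R
  open PowerSeries R
  open OverpartitionSums +-commutativeMonoid
  open OverpartitionSeries R
  open ThetaSeries R
  open WeightedSum
  module Π = BigOperators S.*-commutativeMonoid
  module RingSumₛ = RingSums seriesRing
  open GaussIdentity seriesRing using (pochhammer⁻; pochhammer⁺)
  open import Algebra.Properties.Ring ring using (-1*x≈-x)
  open import Algebra.Properties.Semiring.Exp semiring using (_^_; ^-homo-*; ^-assocʳ)
  open import Algebra.Properties.Semiring.Exp S.semiring using () renaming (_^_ to _^ₛ_)
  open import Algebra.Solver.Ring.NaturalCoefficients.Default S.commutativeSemiring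
  open import Relation.Binary.Reasoning.MultiSetoid

  ovp-factor : ∀ c k → (1ₛ S.- c • q ^ₛ suc k) ⊛ ovp c (suc k) ≋ (1ₛ ⊕ c • q ^ₛ suc k) ⊛ ovp c k
  ovp-factor c k = RingSumₛ.u≈u₀+xu⇒[1-x]u≈u₀ (ovp-unfold c k)

  -- Puts P(1), cut off at parts ≤ n, into the form that `theta-inverse` asks for.
  ovp-1-pochhammer : ∀ n → ovp 1# n ⊛ pochhammer⁻ q n ≋ pochhammer⁺ q n
  ovp-1-pochhammer zero    = S.trans (S.*-identityʳ (ovp 1# 0)) (ovp-zero 1#)
  ovp-1-pochhammer (suc k) = begin⟨ S.setoid ⟩
    ovp 1# (suc k) ⊛ ((1ₛ S.- q ^ₛ suc k) ⊛ pochhammer⁻ q k)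
      ≈⟨ solve 3 (λ o y p → o :* (y :* p) := y :* o :* p) S.refl (ovp 1# (suc k)) (1ₛ S.- q ^ₛ suc k) (pochhammer⁻ q k) ⟩
    (1ₛ S.- q ^ₛ suc k) ⊛ ovp 1# (suc k) ⊛ pochhammer⁻ q k
      ≈⟨ S.*-congʳ {pochhammer⁻ q k} (S.*-congʳ {ovp 1# (suc k)} (λ n → +-congˡ (-‿cong (sym (*-identityˡ _))))) ⟩
    (1ₛ S.- 1# • q ^ₛ suc k) ⊛ ovp 1# (suc k) ⊛ pochhammer⁻ q k
      ≈⟨ S.*-congʳ {pochhammer⁻ q k} (ovp-factor 1# k) ⟩
    (1ₛ ⊕ 1# • q ^ₛ suc k) ⊛ ovp 1# k ⊛ pochhammer⁻ q k
      ≈⟨ S.*-assoc (1ₛ ⊕ 1# • q ^ₛ suc k) (ovp 1# k) (pochhammer⁻ q k) ⟩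
    (1ₛ ⊕ 1# • q ^ₛ suc k) ⊛ (ovp 1# k ⊛ pochhammer⁻ q k)
      ≈⟨ S.*-cong (λ n → +-congˡ (*-identityˡ _)) (ovp-1-pochhammer k) ⟩
    (1ₛ ⊕ q ^ₛ suc k) ⊛ pochhammer⁺ q k ∎

  allOvp : Carrier → Series
  allOvp c n = ⨁ₗ (λ π → c ^ ℓ π) (overpartitions n)

  allOvp-≋[] : ∀ c n → allOvp c ≋[ n ] ovp c n
  allOvp-≋[] c n k k≤n = trans (sym (⨁ₗ-ovpUpTo-stable (n ℕ.∸ k) k (c ^_)))
    (reflexive (≡.cong (λ K → ovp c K k) (ℕ.m∸n+n≡m k≤n)))

  Π-cong-≋[] : ∀ {n} m {f g} → (∀ j → f j ≋[ n ] g j) → Π.⨁ m f ≋[ n ] Π.⨁ m g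
  Π-cong-≋[] zero    f≋g = λ _ _ → refl
  Π-cong-≋[] (suc m) f≋g = ⊛-cong-≋[] (f≋g 0) (Π-cong-≋[] m (f≋g ∘ suc))

  module _ (ζ : Carrier) where
    open Dilation ζ

    coloredSeries : ℕ → ℕ → Series
    coloredSeries w s n = ⨁ₗ (λ v → ζ ^ weightedSum w (lengths v)) (coloredOverpartitions s n)

    -- The initial weight w is a parameter because splitting off the first colour raises it by one
    -- for the others.
    coloredSeries-Π : ∀ w s → coloredSeries w s ≋ Π.⨁ s (λ k → allOvp (ζ ^ (k ℕ.+ w)))
    coloredSeries-Π w zero zero    = +-identityʳ 1#
    coloredSeries-Π w zero (suc n) = refl
    coloredSeries-Π w (suc s) n = begin⟨ setoid ⟩
      coloredSeries w (suc s) n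
        ≈⟨ ⨁ₗ-colored-suc s n (λ as → ζ ^ weightedSum w as) ⟩
      ⨁ (suc n) (λ j → ⨁ₗ (λ π → ⨁ₗ (λ v → ζ ^ (w ℕ.* ℓ π ℕ.+ weightedSum (suc w) (lengths v)))
                                    (coloredOverpartitions s (n ℕ.∸ j))) (overpartitions j))
        ≈⟨ ⨁-cong (suc n) separate ⟩
      ⨁ (suc n) (λ j → allOvp (ζ ^ w) j * coloredSeries (suc w) s (n ℕ.∸ j))
        ≈⟨ sym (⊛-coeff (allOvp (ζ ^ w)) (coloredSeries (suc w) s) n) ⟩
      (allOvp (ζ ^ w) ⊛ coloredSeries (suc w) s) n
        ≈⟨ S.*-congˡ {allOvp (ζ ^ w)} (coloredSeries-Π (suc w) s) n ⟩
      (allOvp (ζ ^ w) ⊛ Π.⨁ s (λ k → allOvp (ζ ^ (k ℕ.+ suc w)))) n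
        ≈⟨ S.*-congˡ {allOvp (ζ ^ w)} (Π.⨁-cong s λ k →
             S.reflexive (≡.cong (allOvp ∘ (ζ ^_)) (ℕ.+-suc k w))) n ⟩
      Π.⨁ (suc s) (λ k → allOvp (ζ ^ (k ℕ.+ w))) n ∎
      where
      separate : ∀ j → ⨁ₗ (λ π → ⨁ₗ (λ v → ζ ^ (w ℕ.* ℓ π ℕ.+ weightedSum (suc w) (lengths v)))
                                      (coloredOverpartitions s (n ℕ.∸ j))) (overpartitions j)
                       ≈ allOvp (ζ ^ w) j * coloredSeries (suc w) s (n ℕ.∸ j)
      separate j = begin⟨ setoid ⟩
        ⨁ₗ (λ π → ⨁ₗ (λ v → ζ ^ (w ℕ.* ℓ π ℕ.+ weightedSum (suc w) (lengths v))) vs) (overpartitions j)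
          ≈⟨ ⨁ₗ-cong (λ π → begin⟨ setoid ⟩
               ⨁ₗ (λ v → ζ ^ (w ℕ.* ℓ π ℕ.+ weightedSum (suc w) (lengths v))) vs
                 ≈⟨ ⨁ₗ-cong (λ v → trans (^-homo-* ζ (w ℕ.* ℓ π) _) (*-congʳ (sym (^-assocʳ ζ w (ℓ π))))) vs ⟩
               ⨁ₗ (λ v → (ζ ^ w) ^ ℓ π * ζ ^ weightedSum (suc w) (lengths v)) vs
                 ≈⟨ sym (*-distribˡ-⨁ₗ _ _ vs) ⟩
               (ζ ^ w) ^ ℓ π * B  ≈⟨ *-comm _ _ ⟩
               B * (ζ ^ w) ^ ℓ π  ∎) (overpartitions j) ⟩
        ⨁ₗ (λ π → B * (ζ ^ w) ^ ℓ π) (overpartitions j)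
          ≈⟨ sym (*-distribˡ-⨁ₗ B _ (overpartitions j)) ⟩
        B * allOvp (ζ ^ w) j
          ≈⟨ *-comm _ _ ⟩
        allOvp (ζ ^ w) j * B ∎
        where
        vs = coloredOverpartitions s (n ℕ.∸ j)
        B = coloredSeries (suc w) s (n ℕ.∸ j)

    dilate-Π : ∀ m f → dilate (Π.⨁ m f) ≋ Π.⨁ m (dilate ∘ f)
    dilate-Π zero    f = dilate-1
    dilate-Π (suc m) f = S.trans (dilate-⊛ (f 0) (Π.⨁ m (f ∘ suc))) (S.*-congˡ {dilate (f 0)} (dilate-Π m (f ∘ suc)))

    dilate-q^ : ∀ d → dilate (q ^ₛ d) ≋ ζ ^ d • q ^ₛ d
    dilate-q^ zero    = S.trans dilate-1 (λ n → sym (*-identityˡ _))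
    dilate-q^ (suc d) = begin⟨ S.setoid ⟩
      dilate (q ⊛ q ^ₛ d)                ≈⟨ dilate-⊛ q (q ^ₛ d) ⟩
      dilate q ⊛ dilate (q ^ₛ d)         ≈⟨ S.*-cong dilate-q (dilate-q^ d) ⟩
      (ζ • q) ⊛ (ζ ^ d • q ^ₛ d)         ≈⟨ •-⊛ ζ q (ζ ^ d • q ^ₛ d) ⟩
      ζ • (q ⊛ (ζ ^ d • q ^ₛ d))         ≈⟨ (λ n → *-congˡ (trans (⊛-comm q (ζ ^ d • q ^ₛ d) n)
                                               (trans (•-⊛ (ζ ^ d) (q ^ₛ d) q n) (*-congˡ (⊛-comm (q ^ₛ d) q n))))) ⟩
      ζ • ζ ^ d • (q ⊛ q ^ₛ d)           ≈⟨ (λ n → sym (*-assoc _ _ _)) ⟩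
      (ζ ^ suc d) • (q ⊛ q ^ₛ d)         ∎

    module _ (s : ℕ) (ζ^t≈1 : ζ ^ suc s ≈ 1#) where
      private t = suc s

      -- With b = 1 these are the numerators and with b = -1 the denominators belonging to part size
      -- d.
      factor : Carrier → ℕ → ℕ → Series
      factor b d k = 1ₛ ⊕ b • ζ ^ k • q ^ₛ d

      factors : Carrier → ℕ → Series
      factors b d = Π.⨁ t (factor b d)

      -- The substitution q ↦ ζ q turns ζ^k q^d into ζ^(d+k) q^d, hence permutes the t factors
      -- cyclically.
      dilate-factors : ∀ b d → dilate (factors b d) ≋ factors b d
      dilate-factors b d = begin⟨ S.setoid ⟩
        dilate (factors b d)               ≈⟨ dilate-Π t (factor b d) ⟩
        Π.⨁ t (dilate ∘ factor b d)        ≈⟨ Π.⨁-cong t shifted ⟩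
        Π.⨁ t (λ k → factor b d (d ℕ.+ k)) ≈⟨ Π.⨁-translate t (factor b d) periodic d ⟩
        factors b d                        ∎
        where
        shifted : ∀ k → dilate (factor b d k) ≋ factor b d (d ℕ.+ k)
        shifted k = S.trans (dilate-⊕ 1ₛ (b • ζ ^ k • q ^ₛ d)) (S.+-cong dilate-1 λ n → begin⟨ setoid ⟩
          dilate (b • ζ ^ k • q ^ₛ d) n    ≈⟨ dilate-• b (ζ ^ k • q ^ₛ d) n ⟩
          b * dilate (ζ ^ k • q ^ₛ d) n    ≈⟨ *-congˡ (dilate-• (ζ ^ k) (q ^ₛ d) n) ⟩
          b * (ζ ^ k * dilate (q ^ₛ d) n)  ≈⟨ *-congˡ (*-congˡ (dilate-q^ d n)) ⟩
          b * (ζ ^ k * (ζ ^ d * (q ^ₛ d) n)) ≈⟨ *-congˡ (sym (*-assoc _ _ _)) ⟩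
          b * (ζ ^ k * ζ ^ d * (q ^ₛ d) n)
            ≈⟨ *-congˡ (*-congʳ (trans (*-comm _ _) (sym (^-homo-* ζ d k)))) ⟩
          b * (ζ ^ (d ℕ.+ k) * (q ^ₛ d) n) ∎)
        periodic : ∀ k → factor b d (k ℕ.+ t) ≋ factor b d k
        periodic k n = +-congˡ (*-congˡ (*-congʳ
          (trans (^-homo-* ζ k t) (trans (*-congˡ ζ^t≈1) (*-identityʳ _)))))

      G : ℕ → Series
      G K = Π.⨁ t (λ k → ovp (ζ ^ k) K)

      G-suc : ∀ K → factors (- 1#) (suc K) ⊛ G (suc K) ≋ factors 1# (suc K) ⊛ G K
      G-suc K = begin⟨ S.setoid ⟩
        factors (- 1#) (suc K) ⊛ G (suc K)
          ≈⟨ S.sym (Π.⨁-∙ t (factor (- 1#) (suc K)) (λ k → ovp (ζ ^ k) (suc K))) ⟩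
        Π.⨁ t (λ k → factor (- 1#) (suc K) k ⊛ ovp (ζ ^ k) (suc K))
          ≈⟨ Π.⨁-cong t step ⟩
        Π.⨁ t (λ k → factor 1# (suc K) k ⊛ ovp (ζ ^ k) K)
          ≈⟨ Π.⨁-∙ t (factor 1# (suc K)) (λ k → ovp (ζ ^ k) K) ⟩
        factors 1# (suc K) ⊛ G K ∎
        where
        step : ∀ k → factor (- 1#) (suc K) k ⊛ ovp (ζ ^ k) (suc K) ≋ factor 1# (suc K) k ⊛ ovp (ζ ^ k) K
        step k = begin⟨ S.setoid ⟩
          factor (- 1#) (suc K) k ⊛ ovp (ζ ^ k) (suc K)
            ≈⟨ S.*-congʳ {ovp (ζ ^ k) (suc K)} (λ n → +-congˡ (-1*x≈-x _)) ⟩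
          (1ₛ S.- ζ ^ k • q ^ₛ suc K) ⊛ ovp (ζ ^ k) (suc K)
            ≈⟨ ovp-factor (ζ ^ k) K ⟩
          (1ₛ ⊕ ζ ^ k • q ^ₛ suc K) ⊛ ovp (ζ ^ k) K
            ≈⟨ S.*-congʳ {ovp (ζ ^ k) K} (λ n → +-congˡ (sym (*-identityˡ _))) ⟩
          factor 1# (suc K) k ⊛ ovp (ζ ^ k) K ∎

      factors-head : ∀ b d → factors b (suc d) 0 ≈ 1#
      factors-head b d = go t (factor b (suc d)) λ k →
        trans (+-congˡ (trans (*-congˡ (trans (*-congˡ (q⊛-zero (q ^ₛ d))) (zeroʳ _))) (zeroʳ b))) (+-identityʳ 1#)
        where
        go : ∀ m f → (∀ k → f k 0 ≈ 1#) → Π.⨁ m f 0 ≈ 1#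
        go zero    f f≈1 = refl
        go (suc m) f f≈1 = trans (*-cong (f≈1 0) (go m (f ∘ suc) (f≈1 ∘ suc))) (*-identityˡ 1#)

      -- In the cross-multiplied recurrence `G-suc` both products of factors are invariant;
      -- cancelling the denominator, whose constant term is 1, passes invariance from K to K + 1.
      dilate-G : ∀ K → dilate (G K) ≋ G K
      dilate-G zero = S.trans (dilate-cong G0≋1) (S.trans dilate-1 (S.sym G0≋1))
        where
        G0≋1 : G 0 ≋ 1ₛ
        G0≋1 = Π.⨁-ε t (λ k _ → ovp-zero (ζ ^ k))
      dilate-G (suc K) = ⊛-cancelˡ (factors (- 1#) (suc K)) (factors-head (- 1#) K) (begin⟨ S.setoid ⟩
        D⁻ ⊛ dilate (G (suc K))          ≈⟨ S.*-congʳ {dilate (G (suc K))} (S.sym (dilate-factors (- 1#) (suc K))) ⟩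
        dilate D⁻ ⊛ dilate (G (suc K))   ≈⟨ S.sym (dilate-⊛ D⁻ (G (suc K))) ⟩
        dilate (D⁻ ⊛ G (suc K))          ≈⟨ dilate-cong (G-suc K) ⟩
        dilate (D⁺ ⊛ G K)                ≈⟨ dilate-⊛ D⁺ (G K) ⟩
        dilate D⁺ ⊛ dilate (G K)         ≈⟨ S.*-cong (dilate-factors 1# (suc K)) (dilate-G K) ⟩
        D⁺ ⊛ G K                         ≈⟨ S.sym (G-suc K) ⟩
        D⁻ ⊛ G (suc K)                   ∎)
        where
        D⁻ = factors (- 1#) (suc K)
        D⁺ = factors 1# (suc K)

      -- `regular` is the sense in which ζ is primitive. Invariance reads ζ^j G_j = G_j, so G_j = 0
      -- unless t divides j; for such j the other factor is a theta coefficient at the nonsquare n -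
      -- j.
      coloredSeries-vanishes :
        (∀ j → ¬ t ∣ j → ∀ x → ζ ^ j * x ≈ x → x ≈ 0#) →
        ∀ n → (∀ j → j ≤ n → t ∣ j → ¬ ∃ λ i → i ℕ.* i ≡ n ℕ.∸ j) →
        coloredSeries 1 s n ≈ 0#
      coloredSeries-vanishes regular n nonsquare = begin⟨ setoid ⟩
        coloredSeries 1 s n                     ≈⟨ coloredSeries-Π 1 s n ⟩
        Π.⨁ s (λ k → allOvp (ζ ^ (k ℕ.+ 1))) n  ≈⟨ Π-cong-≋[] {n} s (λ k → allOvp-≋[] (ζ ^ (k ℕ.+ 1)) n) n ℕ.≤-refl ⟩
        Π.⨁ s (λ k → ovp (ζ ^ (k ℕ.+ 1)) n) n
          ≈⟨ Π.⨁-cong s (λ k → S.reflexive (≡.cong (λ e → ovp (ζ ^ e) n) (ℕ.+-comm k 1))) n ⟩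
        A n                                     ≈⟨ sym (S.*-identityʳ A n) ⟩
        (A ⊛ 1ₛ) n
          -- Inserts 1 as P(1) · theta, which is legitimate up to degree n.
          ≈⟨ ⊛-cong-≤ n {A} (λ _ _ → refl) (λ k k≤n →
               sym (theta-inverse n (ovp 1# n) (ovp-1-pochhammer n) k k≤n)) ⟩
        (A ⊛ (ovp 1# n ⊛ theta n)) n
          -- `ovp 1# n` is the missing factor k = 0, as ζ^0 reduces to 1; it completes the product
          -- to `G n`.
          ≈⟨ solve 3 (λ a o h → a :* (o :* h) := o :* a :* h) S.refl A (ovp 1# n) (theta n) n ⟩
        (G n ⊛ theta n) n                       ≈⟨ ⊛-coeff (G n) (theta n) n ⟩
        ⨁ (suc n) (λ j → G n j * theta n (n ℕ.∸ j))
          ≈⟨ ⨁-ε (suc n) (λ j j<1+n → vanish j (ℕ.≤-pred j<1+n)) ⟩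
        0#                                      ∎
        where
        A = Π.⨁ s (λ k → ovp (ζ ^ suc k) n)
        vanish : ∀ j → j ≤ n → G n j * theta n (n ℕ.∸ j) ≈ 0#
        vanish j j≤n with t ∣? j
        ... | yes t∣j = trans (*-congˡ (theta-nonsquare n (n ℕ.∸ j) (nonsquare j j≤n t∣j))) (zeroʳ _)
        ... | no  t∤j = trans (*-congʳ (regular j t∤j (G n j) (dilate-G n j))) (zeroˡ _)

-- A ring with a primitive t-th root of unity, and residue counts.

module Cyclotomic (s : ℕ) where
  open import Data.Integer as ℤ using (ℤ; +_; 0ℤ; 1ℤ; -1ℤ; _+_; _*_; -_; _-_)
  open import Data.Integer.Tactic.RingSolver using (solve-∀)
  open import Relation.Binary.PropositionalEquality using (_≗_; refl; sym; trans; cong; cong₂; module ≡-Reasoning)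
  open ≡-Reasoning

  private
    t = suc s
    module ℕΣ = BigOperators ℕ.+-0-commutativeMonoid
    module ℤΣ = BigOperators ℤ.+-0-commutativeMonoid

  δ : ℕ → ℕ
  δ i = if does (t ∣? i) then 1 else 0

  δ-cong : ∀ {i j} → t ∣ i ⇔ t ∣ j → δ i ≡ δ j
  δ-cong {i} {j} i⇔j = cong (if_then 1 else 0) (does-⇔ i⇔j (t ∣? i) (t ∣? j))

  δ-periodic : ∀ i → δ (t ℕ.+ i) ≡ δ i
  δ-periodic i = δ-cong (mk⇔ (λ t∣t+i → ∣m+n∣m⇒∣n t∣t+i ∣-refl) (∣m∣n⇒∣m+n ∣-refl))

  ∑δ≡1 : ∀ a → ℕΣ.⨁ t (λ k → δ (a ℕ.+ k)) ≡ 1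
  ∑δ≡1 a = begin
    ℕΣ.⨁ t (λ k → δ (a ℕ.+ k))
      ≡⟨ ℕΣ.⨁-translate t δ (λ k → trans (cong δ (ℕ.+-comm k t)) (δ-periodic k)) a ⟩
    δ 0 ℕ.+ ℕΣ.⨁ s (δ ∘ suc)
      ≡⟨ cong₂ ℕ._+_ (cong (if_then 1 else 0) (dec-true (t ∣? 0) (t ∣0)))
           (ℕΣ.⨁-ε s λ k k<s → cong (if_then 1 else 0) (dec-false (t ∣? suc k) (>⇒∤ (s≤s k<s)))) ⟩
    1 ∎

  -- ℤ[z] acting on sequences by shifts; two polynomials are identified when they agree on
  -- δ₀ = (1 − z) δ, whose annihilator is generated by 1 + z + … + z^(t−1).
  infixl 6 _⊞_
  infixl 7 _⊠_
  data Poly : Set where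
    κ       : ℤ → Poly
    z       : Poly
    _⊞_ _⊠_ : Poly → Poly → Poly

  ⟦_⟧ : Poly → (ℕ → ℤ) → ℕ → ℤ
  ⟦ κ c ⟧   f i = c * f i
  ⟦ z ⟧     f i = f (suc i)
  ⟦ a ⊞ b ⟧ f i = ⟦ a ⟧ f i + ⟦ b ⟧ f i
  ⟦ a ⊠ b ⟧ f   = ⟦ a ⟧ (⟦ b ⟧ f)

  ⟦⟧-cong : ∀ a {f g} → f ≗ g → ⟦ a ⟧ f ≗ ⟦ a ⟧ g
  ⟦⟧-cong (κ c)   f≗g i = cong (c *_) (f≗g i)
  ⟦⟧-cong z       f≗g i = f≗g (suc i)
  ⟦⟧-cong (a ⊞ b) f≗g i = cong₂ _+_ (⟦⟧-cong a f≗g i) (⟦⟧-cong b f≗g i)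
  ⟦⟧-cong (a ⊠ b) f≗g   = ⟦⟧-cong a (⟦⟧-cong b f≗g)

  ⟦⟧-+ : ∀ a f g i → ⟦ a ⟧ (λ j → f j + g j) i ≡ ⟦ a ⟧ f i + ⟦ a ⟧ g i
  ⟦⟧-+ (κ c)   f g i = ℤ.*-distribˡ-+ c (f i) (g i)
  ⟦⟧-+ z       f g i = refl
  ⟦⟧-+ (a ⊞ b) f g i = trans (cong₂ _+_ (⟦⟧-+ a f g i) (⟦⟧-+ b f g i))
    (lemma (⟦ a ⟧ f i) (⟦ a ⟧ g i) (⟦ b ⟧ f i) (⟦ b ⟧ g i))
    where
    lemma : ∀ x y u v → x + y + (u + v) ≡ x + u + (y + v)
    lemma = solve-∀
  ⟦⟧-+ (a ⊠ b) f g i = trans (⟦⟧-cong a (⟦⟧-+ b f g) i) (⟦⟧-+ a (⟦ b ⟧ f) (⟦ b ⟧ g) i)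

  ⟦⟧-scale : ∀ a c f i → ⟦ a ⟧ (λ j → c * f j) i ≡ c * ⟦ a ⟧ f i
  ⟦⟧-scale (κ d)   c f i = lemma d c (f i)
    where
    lemma : ∀ x y u → x * (y * u) ≡ y * (x * u)
    lemma = solve-∀
  ⟦⟧-scale z       c f i = refl
  ⟦⟧-scale (a ⊞ b) c f i =
    trans (cong₂ _+_ (⟦⟧-scale a c f i) (⟦⟧-scale b c f i)) (sym (ℤ.*-distribˡ-+ c _ _))
  ⟦⟧-scale (a ⊠ b) c f i = trans (⟦⟧-cong a (⟦⟧-scale b c f) i) (⟦⟧-scale a c (⟦ b ⟧ f) i)

  ⟦⟧-shift : ∀ a f i → ⟦ a ⟧ (f ∘ suc) i ≡ ⟦ a ⟧ f (suc i)
  ⟦⟧-shift (κ c)   f i = refl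
  ⟦⟧-shift z       f i = refl
  ⟦⟧-shift (a ⊞ b) f i = cong₂ _+_ (⟦⟧-shift a f i) (⟦⟧-shift b f i)
  ⟦⟧-shift (a ⊠ b) f i = trans (⟦⟧-cong a (⟦⟧-shift b f) i) (⟦⟧-shift a (⟦ b ⟧ f) i)

  ⟦⟧-comm : ∀ a b f i → ⟦ a ⟧ (⟦ b ⟧ f) i ≡ ⟦ b ⟧ (⟦ a ⟧ f) i
  ⟦⟧-comm (κ c)    b f i = sym (⟦⟧-scale b c f i)
  ⟦⟧-comm z        b f i = sym (⟦⟧-shift b f i)
  ⟦⟧-comm (a ⊞ a′) b f i =
    trans (cong₂ _+_ (⟦⟧-comm a b f i) (⟦⟧-comm a′ b f i)) (sym (⟦⟧-+ b (⟦ a ⟧ f) (⟦ a′ ⟧ f) i))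
  ⟦⟧-comm (a ⊠ a′) b f i = trans (⟦⟧-cong a (⟦⟧-comm a′ b f) i) (⟦⟧-comm a b (⟦ a′ ⟧ f) i)

  -- Acting on δ itself would give ℤ[z]/(z^t - 1), where z - 1 kills 1 + z + ... + z^(t-1). The
  -- difference makes every window of length t sum to 0, and so removes that obstruction.
  δ₀ : ℕ → ℤ
  δ₀ i = + δ i - + δ (suc i)

  infix 4 _≈_
  _≈_ : Poly → Poly → Set
  a ≈ b = ⟦ a ⟧ δ₀ ≗ ⟦ b ⟧ δ₀

  -- Equality is tested on δ₀ alone, whereas `a` acts on `⟦ b ⟧ δ₀`; commuting the operators brings
  -- `a` next to δ₀.
  ⊠-cong : ∀ {a a′ b b′} → a ≈ a′ → b ≈ b′ → a ⊠ b ≈ a′ ⊠ b′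
  ⊠-cong {a} {a′} {b} {b′} a≈a′ b≈b′ i = begin
    ⟦ a ⟧ (⟦ b ⟧ δ₀) i    ≡⟨ ⟦⟧-cong a b≈b′ i ⟩
    ⟦ a ⟧ (⟦ b′ ⟧ δ₀) i   ≡⟨ ⟦⟧-comm a b′ δ₀ i ⟩
    ⟦ b′ ⟧ (⟦ a ⟧ δ₀) i   ≡⟨ ⟦⟧-cong b′ a≈a′ i ⟩
    ⟦ b′ ⟧ (⟦ a′ ⟧ δ₀) i  ≡⟨ ⟦⟧-comm b′ a′ δ₀ i ⟩
    ⟦ a′ ⟧ (⟦ b′ ⟧ δ₀) i  ∎

  cyclotomicRing : CommutativeRing _ _
  cyclotomicRing = record
    { Carrier = Poly
    ; _≈_ = _≈_
    ; _+_ = _⊞_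
    ; _*_ = _⊠_
    ; -_ = κ -1ℤ ⊠_
    ; 0# = κ 0ℤ
    ; 1# = κ 1ℤ
    ; isCommutativeRing = record
      { isRing = record
        { +-isAbelianGroup = record
          { isGroup = record
            { isMonoid = record
              { isSemigroup = record
                { isMagma = record
                  { isEquivalence = record
                    { refl = λ _ → refl
                    ; sym = λ a≈b i → sym (a≈b i)
                    ; trans = λ a≈b b≈c i → trans (a≈b i) (b≈c i)
                    }
                  ; ∙-cong = λ a≈a′ b≈b′ i → cong₂ _+_ (a≈a′ i) (b≈b′ i)
                  }
                ; assoc = λ a b c i → ℤ.+-assoc (⟦ a ⟧ δ₀ i) _ _
                }
              ; identity = (λ a i → lemma₀ (δ₀ i) (⟦ a ⟧ δ₀ i))
                         , (λ a i → trans (ℤ.+-comm (⟦ a ⟧ δ₀ i) _) (lemma₀ (δ₀ i) (⟦ a ⟧ δ₀ i)))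
              }
            ; inverse = (λ a i → lemma₋ (⟦ a ⟧ δ₀ i) (δ₀ i))
                      , (λ a i → trans (ℤ.+-comm (⟦ a ⟧ δ₀ i) _) (lemma₋ (⟦ a ⟧ δ₀ i) (δ₀ i)))
            ; ⁻¹-cong = λ a≈b i → cong (-1ℤ *_) (a≈b i)
            }
          ; comm = λ a b i → ℤ.+-comm (⟦ a ⟧ δ₀ i) _
          }
        ; *-cong = λ {a} {a′} {b} {b′} → ⊠-cong {a} {a′} {b} {b′}
        ; *-assoc = λ a b c i → refl
        ; *-identity = (λ a i → ℤ.*-identityˡ _)
                     , (λ a i → ⟦⟧-cong a (λ j → ℤ.*-identityˡ (δ₀ j)) i)
        ; distrib = (λ a b c → ⟦⟧-+ a (⟦ b ⟧ δ₀) (⟦ c ⟧ δ₀)) , (λ a b c i → refl)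
        }
      ; *-comm = λ a b → ⟦⟧-comm a b δ₀
      }
    }
    where
    lemma₀ : ∀ x y → 0ℤ * x + y ≡ y
    lemma₀ = solve-∀
    lemma₋ : ∀ x y → -1ℤ * x + x ≡ 0ℤ * y
    lemma₋ = solve-∀

  open CommutativeRing cyclotomicRing using (semiring; 0#; 1#; +-commutativeMonoid)
  open import Algebra.Properties.Semiring.Exp semiring using (_^_)

  ⟦z^⟧ : ∀ j f i → ⟦ z ^ j ⟧ f i ≡ f (j ℕ.+ i)
  ⟦z^⟧ zero    f i = ℤ.*-identityˡ (f i)
  ⟦z^⟧ (suc j) f i = trans (⟦z^⟧ j f (suc i)) (cong f (ℕ.+-suc j i))

  δ₀-periodic : ∀ i → δ₀ (t ℕ.+ i) ≡ δ₀ i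
  δ₀-periodic i = cong₂ (λ a b → + a - + b) (δ-periodic i)
    (trans (cong δ (sym (ℕ.+-suc t i))) (δ-periodic (suc i)))

  z^t≈1 : z ^ t ≈ 1#
  z^t≈1 i = trans (⟦z^⟧ t δ₀ i) (trans (δ₀-periodic i) (sym (ℤ.*-identityˡ (δ₀ i))))

  -- A property of δ₀ inherited by every element of the ring; it is what rules out nonzero constant
  -- sequences.
  ZeroSum : (ℕ → ℤ) → Set
  ZeroSum f = ∀ i → ℤΣ.⨁ t (λ k → f (k ℕ.+ i)) ≡ 0ℤ

  ZeroSum-⟦⟧ : ∀ a {f} → ZeroSum f → ZeroSum (⟦ a ⟧ f)
  ZeroSum-⟦⟧ (κ c) {f} f0 i = trans (sym (*-distribˡ-⨁ c t (λ k → f (k ℕ.+ i)))) (trans (cong (c *_) (f0 i)) (ℤ.*-zeroʳ c))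
    where open RingSums ℤ.+-*-commutativeRing using (*-distribˡ-⨁)
  ZeroSum-⟦⟧ z {f} f0 i = trans (ℤΣ.⨁-cong t λ k → cong f (sym (ℕ.+-suc k i))) (f0 (suc i))
  ZeroSum-⟦⟧ (a ⊞ b) {f} f0 i =
    trans (ℤΣ.⨁-∙ t (λ k → ⟦ a ⟧ f (k ℕ.+ i)) (λ k → ⟦ b ⟧ f (k ℕ.+ i)))
          (cong₂ _+_ (ZeroSum-⟦⟧ a f0 i) (ZeroSum-⟦⟧ b f0 i))
  ZeroSum-⟦⟧ (a ⊠ b) f0 = ZeroSum-⟦⟧ a (ZeroSum-⟦⟧ b f0)

  ZeroSum-δ₀ : ZeroSum δ₀
  ZeroSum-δ₀ i = trans (telescope t (λ k → + δ (k ℕ.+ i))) (trans (cong (λ x → + δ i - + x) (δ-periodic i)) (ℤ.+-inverseʳ (+ δ i)))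
    where
    lemma : ∀ x y u → x - y + (y - u) ≡ x - u
    lemma = solve-∀
    telescope : ∀ n (f : ℕ → ℤ) → ℤΣ.⨁ n (λ k → f k - f (suc k)) ≡ f 0 - f n
    telescope zero    f = sym (ℤ.+-inverseʳ (f 0))
    telescope (suc n) f = trans (cong (_+_ (f 0 - f 1)) (telescope n (f ∘ suc))) (lemma (f 0) (f 1) (f (suc n)))

  iterate-period : ∀ (h : ℕ → ℤ) k → (∀ i → h (k ℕ.+ i) ≡ h i) → ∀ m i → h (m ℕ.* k ℕ.+ i) ≡ h i
  iterate-period h k per zero    i = refl
  iterate-period h k per (suc m) i =
    trans (cong h (ℕ.+-assoc k (m ℕ.* k) i)) (trans (per _) (iterate-period h k per m i))

  -- By Bézout some multiple of one period exceeds a multiple of the other by exactly 1, so two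
  -- invisible shifts differ by one step.
  coprime-periods : ∀ (h : ℕ → ℤ) {j k} → Coprime j k → (∀ i → h (j ℕ.+ i) ≡ h i) → (∀ i → h (k ℕ.+ i) ≡ h i) →
    ∀ i → h (suc i) ≡ h i
  coprime-periods h {j} {k} cop perⱼ perₖ i with coprime-Bézout cop
  ... | Bézout.+- x y eq = begin
    h (suc i)                ≡⟨ sym (iterate-period h k perₖ y (suc i)) ⟩
    h (y ℕ.* k ℕ.+ suc i)    ≡⟨ cong h (trans (ℕ.+-suc (y ℕ.* k) i) (cong (ℕ._+ i) eq)) ⟩
    h (x ℕ.* j ℕ.+ i)        ≡⟨ iterate-period h j perⱼ x i ⟩
    h i                      ∎
  ... | Bézout.-+ x y eq = begin
    h (suc i)                ≡⟨ sym (iterate-period h j perⱼ x (suc i)) ⟩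
    h (x ℕ.* j ℕ.+ suc i)    ≡⟨ cong h (trans (ℕ.+-suc (x ℕ.* j) i) (cong (ℕ._+ i) eq)) ⟩
    h (y ℕ.* k ℕ.+ i)        ≡⟨ iterate-period h k perₖ y i ⟩
    h i                      ∎

  -- A fixed sequence has the coprime periods j and t, so it is constant; its sum over a period is 0.
  z^j-regular : Prime t → ∀ j → ¬ t ∣ j → ∀ x → z ^ j ⊠ x ≈ x → x ≈ 0#
  z^j-regular t-prime j t∤j x fixed i = trans (h≡h0 i) (trans h0≡0 (sym (ℤ.*-zeroˡ (δ₀ i))))
    where
    h = ⟦ x ⟧ δ₀
    coprime : Coprime j t
    coprime (d∣j , d∣t) with prime⇒irreducible t-prime d∣t
    ... | inj₁ d≡1 = d≡1
    ... | inj₂ refl = contradiction d∣j t∤j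
    per-t : ∀ i → h (t ℕ.+ i) ≡ h i
    per-t i = begin
      h (t ℕ.+ i)               ≡⟨ sym (⟦z^⟧ t h i) ⟩
      ⟦ z ^ t ⟧ (⟦ x ⟧ δ₀) i    ≡⟨ ⟦⟧-comm (z ^ t) x δ₀ i ⟩
      ⟦ x ⟧ (⟦ z ^ t ⟧ δ₀) i    ≡⟨ ⟦⟧-cong x (λ k → trans (⟦z^⟧ t δ₀ k) (δ₀-periodic k)) i ⟩
      h i                       ∎
    h-step : ∀ i → h (suc i) ≡ h i
    h-step = coprime-periods h coprime (λ i → trans (sym (⟦z^⟧ j h i)) (fixed i)) per-t
    h≡h0 : ∀ i → h i ≡ h 0
    h≡h0 zero    = refl
    h≡h0 (suc i) = trans (h-step i) (h≡h0 i)
    ⨁-const : ∀ n c → ℤΣ.⨁ n (λ _ → c) ≡ + n * c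
    ⨁-const zero    c = sym (ℤ.*-zeroˡ c)
    ⨁-const (suc n) c = trans (cong (_+_ c) (⨁-const n c)) (sym (ℤ.suc-* (+ n) c))
    h0≡0 : h 0 ≡ 0ℤ
    h0≡0 = case ℤ.i*j≡0⇒i≡0∨j≡0 (+ t) (begin
        + t * h 0                        ≡⟨ sym (⨁-const t (h 0)) ⟩
        ℤΣ.⨁ t (λ _ → h 0)               ≡⟨ ℤΣ.⨁-cong t (λ k → sym (h≡h0 (k ℕ.+ 0))) ⟩
        ℤΣ.⨁ t (λ k → h (k ℕ.+ 0))       ≡⟨ ZeroSum-⟦⟧ x ZeroSum-δ₀ 0 ⟩
        0ℤ                               ∎) of λ where
      (inj₂ eq) → eq

  module _ {A : Set} (wt : A → ℕ) where
    open BigOperators +-commutativeMonoid using (⨁ₗ)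

    -- Mind the sign: index i counts the elements of weight congruent to -i.
    residueCount : List A → ℕ → ℕ
    residueCount xs i = ℕΣ.⨁ₗ (λ x → δ (wt x ℕ.+ i)) xs

    -- The reason for comparing elements on δ₀: a vanishing sum of powers of z makes consecutive
    -- counts equal.
    ⟦⨁ₗ⟧ : ∀ xs i → ⟦ ⨁ₗ (λ x → z ^ wt x) xs ⟧ δ₀ i ≡ + residueCount xs i - + residueCount xs (suc i)
    ⟦⨁ₗ⟧ []       i = ℤ.*-zeroˡ (δ₀ i)
    ⟦⨁ₗ⟧ (x ∷ xs) i = begin
      ⟦ z ^ wt x ⟧ δ₀ i + ⟦ ⨁ₗ (λ x → z ^ wt x) xs ⟧ δ₀ i
        ≡⟨ cong₂ _+_ (⟦z^⟧ (wt x) δ₀ i) (⟦⨁ₗ⟧ xs i) ⟩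
      + δ (wt x ℕ.+ i) - + δ (suc (wt x ℕ.+ i)) + (+ residueCount xs i - + residueCount xs (suc i))
        ≡⟨ cong (λ m → + δ (wt x ℕ.+ i) - + δ m + (+ residueCount xs i - + residueCount xs (suc i))) (sym (ℕ.+-suc (wt x) i)) ⟩
      + δ (wt x ℕ.+ i) - + δ (wt x ℕ.+ suc i) + (+ residueCount xs i - + residueCount xs (suc i))
        ≡⟨ lemma (+ δ (wt x ℕ.+ i)) (+ δ (wt x ℕ.+ suc i)) (+ residueCount xs i) (+ residueCount xs (suc i)) ⟩
      + residueCount (x ∷ xs) i - + residueCount (x ∷ xs) (suc i) ∎
      where
      lemma : ∀ a b c d → a - b + (c - d) ≡ a + c - (b + d)
      lemma = solve-∀

    residueCount-constant : ∀ xs → ⨁ₗ (λ x → z ^ wt x) xs ≈ 0# → ∀ i → residueCount xs i ≡ residueCount xs 0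
    residueCount-constant xs ≈0 zero    = refl
    residueCount-constant xs ≈0 (suc i) = trans (sym (ℤ.+-injective (ℤ.i-j≡0⇒i≡j _ _
      (trans (sym (⟦⨁ₗ⟧ xs i)) (trans (≈0 i) (ℤ.*-zeroˡ (δ₀ i))))))) (residueCount-constant xs ≈0 i)

    ∑-residueCount : ∀ xs → ℕΣ.⨁ t (residueCount xs) ≡ length xs
    ∑-residueCount xs = trans (ℕΣ.⨁-⨁ₗ-comm t (λ k x → δ (wt x ℕ.+ k)) xs)
      (trans (ℕΣ.⨁ₗ-cong (λ x → ∑δ≡1 (wt x)) xs) (⨁ₗ-1 xs))
      where
      ⨁ₗ-1 : ∀ xs → ℕΣ.⨁ₗ (λ (_ : A) → 1) xs ≡ length xs
      ⨁ₗ-1 []       = refl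
      ⨁ₗ-1 (x ∷ xs) = cong suc (⨁ₗ-1 xs)

    residueCount*t : ∀ xs → ⨁ₗ (λ x → z ^ wt x) xs ≈ 0# → ∀ i → residueCount xs i ℕ.* t ≡ length xs
    residueCount*t xs ≈0 i = trans (trans (ℕ.*-comm _ t) (sym (⨁-const t _)))
      (trans (ℕΣ.⨁-cong t λ k → trans (residueCount-constant xs ≈0 i) (sym (residueCount-constant xs ≈0 k)))
             (∑-residueCount xs))
      where
      ⨁-const : ∀ n c → ℕΣ.⨁ n (λ _ → c) ≡ n ℕ.* c
      ⨁-const zero    c = refl
      ⨁-const (suc n) c = cong (c ℕ.+_) (⨁-const n c)

-- Equidistribution and parity of the multirank counts.

open import Data.Integer as ℤ using (ℤ; +_; ∣_∣)
open import Data.Nat using (_+_; _*_; _∸_)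
open import Data.Integer.Divisibility.Signed as Signed using (∣ᵤ⇒∣; ∣⇒∣ᵤ)
open import Data.Integer.Tactic.RingSolver using (solve-∀)
open import Relation.Binary.PropositionalEquality using (refl; sym; trans; cong; cong₂; subst; module ≡-Reasoning)
open BigOperators ℕ.+-0-commutativeMonoid using (⨁ₗ; ⨁ₗ-cong)
open OverpartitionSums ℕ.+-0-commutativeMonoid using (Double-colored)
open Vanishing using (coloredSeries-vanishes)
open Cyclotomic using (δ; cyclotomicRing; z; z^t≈1; z^j-regular; residueCount; residueCount*t)
open WeightedSum

length-filter-⨁ₗ : ∀ {A : Set} {P : Pred A 0ℓ} (P? : Decidable P) xs →
  length (filter P? xs) ≡ ⨁ₗ (λ x → if does (P? x) then 1 else 0) xs
length-filter-⨁ₗ P? []       = refl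
length-filter-⨁ₗ P? (x ∷ xs) with P? x
... | yes _ = cong suc (length-filter-⨁ₗ P? xs)
... | no  _ = length-filter-⨁ₗ P? xs

∣∣-resp-multiple : ∀ {t} x y k → x ≡ y ℤ.+ k ℤ.* + t → (t ∣ ∣ x ∣) ⇔ (t ∣ ∣ y ∣)
∣∣-resp-multiple {t} x y k refl = mk⇔
  (λ t∣x → ∣⇒∣ᵤ {+ t} {y} (Signed.∣m+n∣n⇒∣m {+ t} {y} (∣ᵤ⇒∣ {+ t} {x} t∣x) t∣kt))
  (λ t∣y → ∣⇒∣ᵤ {+ t} {x} (Signed.∣m∣n⇒∣m+n (∣ᵤ⇒∣ {+ t} {y} t∣y) t∣kt))
  where
  t∣kt : + t Signed.∣ k ℤ.* + t
  t∣kt = Signed.divides k refl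

odd⇒1+half*2 : ∀ t → ¬ 2 ∣ t → t ≡ suc (t / 2 * 2)
odd⇒1+half*2 t 2∤t with t % 2 in eq | m%n<n t 2
... | zero        | _ = contradiction (m%n≡0⇒n∣m t 2 eq) 2∤t
... | suc zero    | _ = trans (m≡m%n+[m/n]*n t 2) (cong (_+ t / 2 * 2) eq)
... | suc (suc _) | s≤s (s≤s ())

-- A square n - j with t dividing j would be a square congruent to n. The case j = n is included,
-- because the definition of nonresidue also excludes x = 0.
nonresidue⇒nonsquare : ∀ {t n} → QuadraticNonresidue t n →
  ∀ j → j ≤ n → t ∣ j → ¬ ∃ λ i → i * i ≡ n ∸ j
nonresidue⇒nonsquare {t} {n} nonres j j≤n t∣j (i , i²≡n∸j) = nonres (i , subst (t ∣_) (sym (begin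
  ∣ + (i * i) ℤ.- + n ∣            ≡⟨ cong₂ (λ x y → ∣ + x ℤ.- + y ∣) i²≡n∸j (sym (ℕ.m∸n+n≡m j≤n)) ⟩
  ∣ + (n ∸ j) ℤ.- + (n ∸ j + j) ∣  ≡⟨ cong ∣_∣ (lemma (+ (n ∸ j)) (+ j)) ⟩
  ∣ ℤ.- + j ∣                      ≡⟨ ℤ.∣-i∣≡∣i∣ (+ j) ⟩
  j                                ∎)) t∣j)
  where
  open ≡-Reasoning
  lemma : ∀ x y → x ℤ.- (x ℤ.+ y) ≡ ℤ.- y
  lemma = solve-∀

module _ (h : ℕ) where
  private
    s t : ℕ
    s = h * 2
    t = suc s

  weight : Vec Overpartition s → ℕ
  weight v = weightedSum 1 (lengths v)

  -- The index is t - i because `residueCount` carries the opposite sign, and -i must be represented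
  -- by a natural number.
  Nbar-residueCount : ∀ i n → i ≤ t →
    Nbar s i t n ≡ residueCount s weight (coloredOverpartitions s n) (t ∸ i)
  Nbar-residueCount i n i≤t = trans
    (length-filter-⨁ₗ (λ v → t ∣? ∣ multirank v ℤ.- + i ∣) (coloredOverpartitions s n))
    (⨁ₗ-cong (λ v → cong (if_then 1 else 0)
      (does-⇔ (∣∣-resp-multiple (multirank v ℤ.- + i) (+ (weight v + (t ∸ i))) (multiple v) (shift v))
        (t ∣? ∣ multirank v ℤ.- + i ∣) (t ∣? (weight v + (t ∸ i))))) (coloredOverpartitions s n))
    where
    open ≡-Reasoning
    lemma : ∀ w t B d i → w ℤ.- t ℤ.* B ℤ.- i ≡ w ℤ.+ d ℤ.+ (ℤ.- B ℤ.* t ℤ.- (d ℤ.+ i))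
    lemma = solve-∀
    lemma′ : ∀ w t B d → w ℤ.+ d ℤ.+ (ℤ.- B ℤ.* t ℤ.- t) ≡ w ℤ.+ d ℤ.+ (ℤ.- B ℤ.- + 1) ℤ.* t
    lemma′ = solve-∀
    multiple : Vec Overpartition s → ℤ
    -- The sum comes from `multirank-≡`, the extra -1 from replacing -i by t - i.
    multiple v = ℤ.- + sum (drop h (lengths v)) ℤ.- + 1
    shift : ∀ v → multirank v ℤ.- + i ≡ + (weight v + (t ∸ i)) ℤ.+ multiple v ℤ.* + t
    shift v = begin
      multirank v ℤ.- + i
        ≡⟨ cong (ℤ._- + i) (multirank-≡ h v) ⟩
      + weight v ℤ.- + (t * B) ℤ.- + i
        ≡⟨ cong (λ x → + weight v ℤ.- x ℤ.- + i) (ℤ.pos-* t B) ⟩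
      + weight v ℤ.- + t ℤ.* + B ℤ.- + i
        ≡⟨ lemma (+ weight v) (+ t) (+ B) (+ (t ∸ i)) (+ i) ⟩
      + weight v ℤ.+ + (t ∸ i) ℤ.+ (ℤ.- + B ℤ.* + t ℤ.- + (t ∸ i + i))
        ≡⟨ cong (λ x → + weight v ℤ.+ + (t ∸ i) ℤ.+ (ℤ.- + B ℤ.* + t ℤ.- + x)) (ℕ.m∸n+n≡m i≤t) ⟩
      + weight v ℤ.+ + (t ∸ i) ℤ.+ (ℤ.- + B ℤ.* + t ℤ.- + t)
        ≡⟨ lemma′ (+ weight v) (+ t) (+ B) (+ (t ∸ i)) ⟩
      + (weight v + (t ∸ i)) ℤ.+ (ℤ.- + B ℤ.- + 1) ℤ.* + t ∎
      where B = sum (drop h (lengths v))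

  Nbar-equidistributed : Prime t → ∀ n → QuadraticNonresidue t n → ∀ i → i ≤ t → Nbar s i t n * t ≡ pbar s n
  Nbar-equidistributed t-prime n nonres i i≤t = trans (cong (_* t) (Nbar-residueCount i n i≤t))
    (residueCount*t s weight (coloredOverpartitions s n)
      (coloredSeries-vanishes (cyclotomicRing s) z s (z^t≈1 s) (z^j-regular s t-prime) n (nonresidue⇒nonsquare nonres))
      (t ∸ i))

  -- Membership in a residue class depends on the lengths alone, so its indicator is an admissible F
  -- for `Double-colored`.
  Nbar-even : ∀ i n → i ≤ t → 1 ≤ n → 2 ∣ Nbar s i t n
  Nbar-even i (suc n) i≤t _ with Double-colored s n (λ as → δ s (weightedSum 1 as + (t ∸ i)))
  ... | m , count≡m+m = divides m (trans (Nbar-residueCount i (suc n) i≤t)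
    (trans count≡m+m (trans (cong (_+_ m) (sym (ℕ.+-identityʳ m))) (ℕ.*-comm 2 m))))

theorem2p3 : (t : ℕ) → Prime t → ¬ (2 ∣ t) →
    (n : ℕ) → 1 ≤ n → QuadraticNonresidue t n →
    (i : ℕ) → i < t →
    (Nbar (t ∸ 1) i t n * t ≡ pbar (t ∸ 1) n)
    × (2 ∣ Nbar (t ∸ 1) i t n)
    × ((2 * t) ∣ pbar (t ∸ 1) n)
theorem2p3 t t-prime 2∤t n 1≤n nonres i i<t with t / 2 | odd⇒1+half*2 t 2∤t
-- Matching replaces t by `suc (h * 2)`, so that `t ∸ 1` computes to the even number of colours
-- `h * 2`.
... | h | refl = equidistributed , even , subst (2 * t ∣_) equidistributed (*-monoˡ-∣ t even)
  where
  equidistributed : Nbar (h * 2) i t n * t ≡ pbar (h * 2) n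
  equidistributed = Nbar-equidistributed h t-prime n nonres i (ℕ.<⇒≤ i<t)
  even : 2 ∣ Nbar (h * 2) i t n
  even = Nbar-even h i n (ℕ.<⇒≤ i<t) 1≤n
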